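{- Every $\overline{S_{1,1,2}}$-free chordal graph has clique-width at most $4$.
   Context: All graphs are finite, simple and undirected. $G$ is $H$-free if it has no induced subgraph isomorphic to $H$. A graph is chordal if it contains no induced cycle $C_r$ with $r\geq 4$. $S_{1,1,2}$ (the chair) is the tree with exactly one vertex $x$ of degree 3 and exactly three leaves, at distances $1,1,2$ from $x$; $\overline{S_{1,1,2}}$ is its complement. The clique-width of a graph $G$ is the minimum number $k$ of labels needed to construct $G$ using the operations: create a single vertex with label $i$; take the disjoint union of two labelled graphs; add all edges between vertices of label $i$ and vertices of label $j$ ($i\neq j$); rename label $i$ to $j$. -}

module Defs where

open import Data.Nat using (ℕ; zero; suc; _+_; _≡ᵇ_)
open import Data.Bool using (Bool; true; false; _∨_; _∧_; not; if_then_else_)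
open import Data.Bool.Properties using (∨-comm)
open import Data.Fin using (Fin; toℕ; splitAt; _≟_)
open import Data.Sum using (_⊎_; inj₁; inj₂)
open import Data.Product using (Σ; _×_; _,_; ∃-syntax)
open import Relation.Nullary using (¬_; does; yes; no)
open import Relation.Binary.PropositionalEquality using (_≡_; _≢_; refl; sym)
open import Function.Definitions using (Injective)

record Graph : Set where
  field
    n      : ℕ
    adj    : Fin n → Fin n → Bool
    adj-sym    : ∀ i j → adj i j ≡ adj j i
    adj-irrefl : ∀ i → adj i i ≡ false
open Graph public

InducedSubgraph : Graph → Graph → Set
InducedSubgraph H G =
  Σ (Fin (n H) → Fin (n G)) λ f →
    Injective _≡_ _≡_ f × (∀ i j → adj H i j ≡ adj G (f i) (f j))

_Free_ : Graph → Graph → Set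
H Free G = ¬ InducedSubgraph H G

private
  dec-sym : ∀ {m} (i j : Fin m) → does (i ≟ j) ≡ does (j ≟ i)
  dec-sym i j with i ≟ j | j ≟ i
  ... | yes _ | yes _ = refl
  ... | no _  | no _  = refl
  ... | yes p | no q  = Data.Empty.⊥-elim (q (sym p))
    where import Data.Empty
  ... | no p  | yes q = Data.Empty.⊥-elim (p (sym q))
    where import Data.Empty

  dec-refl : ∀ {m} (i : Fin m) → does (i ≟ i) ≡ true
  dec-refl i with i ≟ i
  ... | yes _ = refl
  ... | no p  = Data.Empty.⊥-elim (p refl)
    where import Data.Empty

complement : Graph → Graph
complement G = record
  { n = n G
  ; adj = cadj
  ; adj-sym = csym
  ; adj-irrefl = cirr
  }
  where
  cadj : Fin (n G) → Fin (n G) → Bool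
  cadj i j = if does (i ≟ j) then false else not (adj G i j)
  csym : ∀ i j → cadj i j ≡ cadj j i
  csym i j rewrite dec-sym i j | adj-sym G i j = refl
  cirr : ∀ i → cadj i i ≡ false
  cirr i rewrite dec-refl i = refl

-- The chair S_{1,1,2}: vertex 0 = centre x of degree 3,
-- leaves 1, 2 (distance 1) and 3 (distance 2, via vertex 4).
-- Edges: 0-1, 0-2, 0-4, 4-3.

private
  chairE : ℕ → ℕ → Bool
  chairE 0 1 = true
  chairE 0 2 = true
  chairE 0 4 = true
  chairE 4 3 = true
  chairE _ _ = false

  chairAdj : Fin 5 → Fin 5 → Bool
  chairAdj i j = chairE (toℕ i) (toℕ j) ∨ chairE (toℕ j) (toℕ i)

  chairIrr : ∀ i → chairAdj i i ≡ false
  chairIrr Fin.zero = refl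
  chairIrr (Fin.suc Fin.zero) = refl
  chairIrr (Fin.suc (Fin.suc Fin.zero)) = refl
  chairIrr (Fin.suc (Fin.suc (Fin.suc Fin.zero))) = refl
  chairIrr (Fin.suc (Fin.suc (Fin.suc (Fin.suc Fin.zero)))) = refl

S112 : Graph
S112 = record
  { n = 5
  ; adj = chairAdj
  ; adj-sym = λ i j → ∨-comm (chairE (toℕ i) (toℕ j)) (chairE (toℕ j) (toℕ i))
  ; adj-irrefl = chairIrr
  }

co-S112 : Graph
co-S112 = complement S112

-- Cycles.  Cycle k is the cycle C_{k+4} on vertices 0,…,k+3 with
-- edges {x, x+1} and {0, k+3}.

private
  ≡ᵇ-suc : ∀ x → (x ≡ᵇ suc x) ≡ false
  ≡ᵇ-suc zero = refl
  ≡ᵇ-suc (suc x) = ≡ᵇ-suc x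

  cycE : ℕ → ℕ → ℕ → Bool
  cycE m x y = (y ≡ᵇ suc x) ∨ ((x ≡ᵇ 0) ∧ (y ≡ᵇ m))

  cycIrrE : ∀ k x → cycE (suc (suc (suc k))) x x ≡ false
  cycIrrE k zero = refl
  cycIrrE k (suc x) rewrite ≡ᵇ-suc x = refl

Cycle : ℕ → Graph
Cycle k = record
  { n = suc (suc (suc (suc k)))
  ; adj = cadj
  ; adj-sym = λ i j → ∨-comm (cycE m (toℕ i) (toℕ j)) (cycE m (toℕ j) (toℕ i))
  ; adj-irrefl = λ i → cirr i
  }
  where
  m : ℕ
  m = suc (suc (suc k))
  cadj : Fin (suc m) → Fin (suc m) → Bool
  cadj i j = cycE m (toℕ i) (toℕ j) ∨ cycE m (toℕ j) (toℕ i)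
  cirr : ∀ i → cadj i i ≡ false
  cirr i rewrite cycIrrE k (toℕ i) = refl

Chordal : Graph → Set
Chordal G = ∀ k → Cycle k Free G

data Expr (k : ℕ) : ℕ → Set where
  vtx : Fin k → Expr k 1
  _⊕_ : ∀ {a b} → Expr k a → Expr k b → Expr k (a + b)
  η   : ∀ {a} (i j : Fin k) → i ≢ j → Expr k a → Expr k a
  ρ   : ∀ {a} (i j : Fin k) → Expr k a → Expr k a

label : ∀ {k a} → Expr k a → Fin a → Fin k
label (vtx i) _ = i
label (_⊕_ {a} e f) x with splitAt a x
... | inj₁ x' = label e x'
... | inj₂ x' = label f x'
label (η i j _ e) x = label e x
label (ρ i j e) x = if does (label e x ≟ i) then j else label e x

eadj : ∀ {k a} → Expr k a → Fin a → Fin a → Bool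
eadj (vtx i) _ _ = false
eadj (_⊕_ {a} e f) x y with splitAt a x | splitAt a y
... | inj₁ x' | inj₁ y' = eadj e x' y'
... | inj₂ x' | inj₂ y' = eadj f x' y'
... | _ | _ = false
eadj (η i j _ e) x y =
  eadj e x y
  ∨ (does (label e x ≟ i) ∧ does (label e y ≟ j))
  ∨ (does (label e x ≟ j) ∧ does (label e y ≟ i))
eadj (ρ i j e) x y = eadj e x y

-- G has clique-width at most k: G is the empty graph (convention
-- cw = 0), or G is isomorphic to the graph built by some k-expression.
CliqueWidth≤ : ℕ → Graph → Set
CliqueWidth≤ k G =
  n G ≡ 0 ⊎
  (Σ (Expr k (n G)) λ e →
     Σ (Fin (n G) → Fin (n G)) λ f →
       Injective _≡_ _≡_ f × (∀ x y → adj G x y ≡ eadj e (f x) (f y)))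

{-# OPTIONS --safe #-}
-- It suffices to build G with two labels by steps that take a disjoint union, add the edges
-- between the two parts as prescribed by the labels, and then merge labels within each part:
-- four labels keep the two parts apart during such a step.
--
-- If a set S of vertices induces no diamond, it is a block graph: removing a vertex r, the
-- neighbours of r in a component C of the rest form a clique (otherwise there is a long induced
-- cycle or a diamond), so C can be glued to r along this clique.  Otherwise some e has a
-- neighbourhood component D that is not a clique.  Let W be the set of vertices of D that are
-- not universal in D.
--   * If no non-neighbour of e sees W, then W is a module, and it is substituted for a vertex.
--   * If one sees W and D has a universal vertex u, then u has a larger such component.
--   * Otherwise W = D.  Kite-freeness forces all non-neighbours of e seeing D to have the same
--     trace A on D, every vertex of D outside A to miss at most one vertex of A, and D together
--     with e and these vertices to be a union of components of S.  It is a thick spider with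
--     body A ∪ {e} whose legs and head are replaced by arbitrary graphs.

module Submission where

open import Defs
open import Data.Bool using (Bool; true; false; _∨_; _∧_; if_then_else_)
import Data.Bool as Bool
open import Data.Bool.Properties using (∨-identityʳ; ∨-comm; ∧-zeroʳ; ∧-identityʳ; ¬-not)
open import Data.Fin using (Fin; zero; suc; toℕ; splitAt; _≟_; _↑ˡ_; _↑ʳ_; Fin′; inject; fromℕ<)
import Data.Fin as Fin
open import Data.Fin.Patterns
open import Data.Fin.Properties using (splitAt-↑ˡ; splitAt-↑ʳ; splitAt⁻¹-↑ˡ; splitAt⁻¹-↑ʳ;
  injective⇒≤; <-cmp; any?; toℕ-injective; toℕ-inject; toℕ-fromℕ<)
open import Data.Fin.Subset using (Subset; _∈_; _∉_; _⊆_; _⊂_; _⊃_; Empty; ⊤; ⊥; ⁅_⁆; _∪_)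
open import Data.Fin.Subset.Induction using (⊂-wellFounded; ⊃-wellFounded; Acc; acc)
open import Data.Fin.Subset.Properties using (_∈?_; ∈⊤; ∉⊥; x∈⁅x⁆; x∈⁅y⁆⇒x≡y; x∈p∪q⁻; p⊆p∪q; q⊆p∪q)
open import Data.List using (List; []; _∷_; length; lookup)
open import Data.List.Membership.Propositional.Properties using (∈-lookup)
open import Data.List.Relation.Unary.All as All using (All; []; _∷_)
open import Data.Maybe using (Maybe; just; nothing; fromMaybe)
open import Data.Nat using (ℕ; s≤s; s<s; _≡ᵇ_)
import Data.Nat as ℕ
import Data.Nat.Properties as ℕ
open import Data.Product using (_×_; _,_; proj₁; proj₂; ∃; ∃₂)
open import Data.Sum using (_⊎_; inj₁; inj₂; [_,_]′; swap)
open import Data.Vec using (tabulate)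
open import Data.Vec.Properties using (lookup∘tabulate; []=⇒lookup; lookup⇒[]=)
open import Function using (_∘_; flip; id; mk⇔)
open import Relation.Binary using (tri<; tri≈; tri>)
open import Relation.Binary.Construct.Closure.ReflexiveTransitive
  using (Star; ε; _◅_; _◅◅_; reverse; map; return)
open import Relation.Binary.PropositionalEquality
open import Relation.Nullary using (¬_; Dec; yes; no; does; contradiction; _×-dec_; _⊎-dec_; ¬?)
open import Relation.Nullary.Decidable using (dec-true; dec-false; does-⇔)

-- Subsets cut out by decidable predicates, and induced embeddings

module _ {m : ℕ} {P : Fin m → Set} (P? : ∀ v → Dec (P v)) where

  sep : Subset m
  sep = tabulate (λ v → does (P? v))

  ∈sep⁺ : ∀ {v} → P v → v ∈ sep
  ∈sep⁺ {v} p = lookup⇒[]= v sep (trans (lookup∘tabulate _ v) (dec-true (P? v) p))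

  ∈sep⁻ : ∀ {v} → v ∈ sep → P v
  ∈sep⁻ {v} v∈ with P? v | trans (sym (lookup∘tabulate (λ v → does (P? v)) v)) ([]=⇒lookup v∈)
  ... | yes p | _ = p

-- Symmetry and irreflexivity reduce an induced embedding to the pairs i < j.
induced : (H G : Graph) (f : Fin (n H) → Fin (n G)) →
          (∀ i j → i Fin.< j → f i ≢ f j × adj H i j ≡ adj G (f i) (f j)) → InducedSubgraph H G
induced H G f ok = f , f-injective , f-adj
  where
  f-injective : ∀ {i j} → f i ≡ f j → i ≡ j
  f-injective {i} {j} eq with <-cmp i j
  ... | tri< i<j _ _ = contradiction eq (proj₁ (ok i j i<j))
  ... | tri≈ _ i≡j _ = i≡j
  ... | tri> _ _ j<i = contradiction (sym eq) (proj₁ (ok j i j<i))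
  f-adj : ∀ i j → adj H i j ≡ adj G (f i) (f j)
  f-adj i j with <-cmp i j
  ... | tri< i<j _ _ = proj₂ (ok i j i<j)
  ... | tri≈ _ refl _ = trans (adj-irrefl H i) (sym (adj-irrefl G (f i)))
  ... | tri> _ _ j<i = trans (adj-sym H i j) (trans (proj₂ (ok j i j<i)) (adj-sym G (f j) (f i)))

-- Quantifying over `Fin′ j` lets a concrete pattern be checked by listing exactly its pairs
-- `i < j`, with no absurd cases.
induced′ : (H G : Graph) (f : Fin (n H) → Fin (n G)) →
           (∀ j (i : Fin′ j) → f (inject i) ≢ f j × adj H (inject i) j ≡ adj G (f (inject i)) (f j)) →
           InducedSubgraph H G
induced′ H G f ok = induced H G f λ i j i<j →
  subst (λ k → f k ≢ f j × adj H k j ≡ adj G (f k) (f j))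
    (toℕ-injective (trans (toℕ-inject (fromℕ< i<j)) (toℕ-fromℕ< i<j)))
    (ok j (fromℕ< i<j))

-- Adjacency, forbidden 4-cycles and kites

module Adjacency (G : Graph) where
  V : Set
  V = Fin (n G)

  infix 4 _~_ _≁_ _~?_
  _~_ _≁_ : V → V → Set
  u ~ v = adj G u v ≡ true
  u ≁ v = ¬ u ~ v

  _~?_ : ∀ u v → Dec (u ~ v)
  u ~? v = adj G u v Bool.≟ true

  ~-sym : ∀ {u v} → u ~ v → v ~ u
  ~-sym {u} {v} = trans (adj-sym G v u)

  ≁-sym : ∀ {u v} → u ≁ v → v ≁ u
  ≁-sym u≁v v~u = u≁v (~-sym v~u)

  ~⇒≢ : ∀ {u v} → u ~ v → u ≢ v
  ~⇒≢ {u} u~u refl with trans (sym u~u) (adj-irrefl G u)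
  ... | ()

  ≁⇒false : ∀ {u v} → u ≁ v → adj G u v ≡ false
  ≁⇒false = ¬-not

  ~≁⇒≢ : ∀ {u v w} → u ~ w → v ≁ w → u ≢ v
  ~≁⇒≢ u~w v≁w refl = v≁w u~w

  private
    edge : ∀ {u v} → u ~ v → u ≢ v × true ≡ adj G u v
    edge u~v = ~⇒≢ u~v , sym u~v

    nonedge : ∀ {u v} → u ≢ v → u ≁ v → u ≢ v × false ≡ adj G u v
    nonedge u≢v u≁v = u≢v , sym (≁⇒false u≁v)

  module _ (chordal : Chordal G) where

    four-cycle-chord : ∀ {a c u v} → a ~ u → c ~ u → a ~ v → c ~ v → a ≢ c → a ≁ c → u ≢ v → u ~ v
    four-cycle-chord {a} {c} {u} {v} au cu av cv a≢c a≁c u≢v with u ~? v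
    ... | yes u~v = u~v
    ... | no u≁v = contradiction (induced′ (Cycle 0) G f ok) (chordal 0)
      where
      f : Fin 4 → V
      f 0F = a
      f 1F = u
      f 2F = c
      f 3F = v
      ok : ∀ j (i : Fin′ j) → _
      ok 1F 0F = edge au
      ok 2F 0F = nonedge a≢c a≁c
      ok 2F 1F = edge (~-sym cu)
      ok 3F 0F = edge av
      ok 3F 1F = nonedge u≢v u≁v
      ok 3F 2F = edge cv

    module _ (kite-free : co-S112 Free G) where

      -- `co-S112` is the kite: a diamond with a pendant vertex at one of its two nonadjacent tips.
      -- Here the tips are `a` and `c`. Chordality forbids `x ~ c`, because `a`, `x`, `c`, `v` would
      -- be an induced 4-cycle; so if `x` also missed `b`, it would be the pendant vertex of a kite.
      diamond-neighbour : ∀ {v b a c x} → v ~ b → a ~ v → a ~ b → c ~ v → c ~ b → a ≢ c → a ≁ c →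
                          x ~ a → x ≢ v → x ≢ b → x ≁ v → x ~ b
      diamond-neighbour {v} {b} {a} {c} {x} vb av ab cv cb a≢c a≁c xa x≢v x≢b x≁v with x ~? b
      ... | yes x~b = x~b
      ... | no x≁b = contradiction (induced′ co-S112 G f ok) kite-free
        where
        x≁c : x ≁ c
        x≁c xc = x≁v (four-cycle-chord (~-sym xa) (~-sym xc) av cv a≢c a≁c x≢v)
        f : Fin 5 → V
        f 0F = x
        f 1F = v
        f 2F = b
        f 3F = a
        f 4F = c
        ok : ∀ j (i : Fin′ j) → _
        ok 1F 0F = nonedge x≢v x≁v
        ok 2F 0F = nonedge x≢b x≁b
        ok 2F 1F = edge vb
        ok 3F 0F = edge xa
        ok 3F 1F = edge (~-sym av)
        ok 3F 2F = edge (~-sym ab)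
        ok 4F 0F = nonedge (≢-sym (~≁⇒≢ cv x≁v)) x≁c
        ok 4F 1F = edge (~-sym cv)
        ok 4F 2F = edge (~-sym cb)
        ok 4F 3F = nonedge a≢c a≁c

  -- Connected components of induced subgraphs

  Within : Subset (n G) → V → V → Set
  Within C u v = u ∈ C × v ∈ C × u ~ v

  record Component (T : Subset (n G)) (x : V) : Set where
    field
      C         : Subset (n G)
      C⊆T       : C ⊆ T
      x∈C       : x ∈ C
      closed    : ∀ {u v} → u ∈ C → v ∈ T → u ~ v → v ∈ C
      connected : ∀ {u v} → u ∈ C → v ∈ C → Star (Within C) u v

  -- Starting from `⁅ x ⁆`, a vertex of `T` adjacent to the current set is added as long as there is
  -- one. Walks from `x` are maintained throughout; reversing one and appending another connects any
  -- two vertices.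
  component : ∀ T {x} → x ∈ T → Component T x
  component T {x} x∈T = grow ⁅ x ⁆ (⊃-wellFounded ⁅ x ⁆) (x∈⁅x⁆ x)
    (λ u∈ → subst (_∈ T) (sym (x∈⁅y⁆⇒x≡y x u∈)) x∈T)
    (λ u∈ → subst (Star _ x) (sym (x∈⁅y⁆⇒x≡y x u∈)) ε)
    where
    Within-sym : ∀ {C u v} → Within C u v → Within C v u
    Within-sym (u∈ , v∈ , u~v) = v∈ , u∈ , ~-sym u~v

    grow : ∀ C → Acc _⊃_ C → x ∈ C → C ⊆ T → (∀ {v} → v ∈ C → Star (Within C) x v) → Component T x
    grow C (acc rec) x∈C C⊆T reach
      with any? (λ v → any? (λ u → u ∈? C ×-dec v ∈? T ×-dec u ~? v ×-dec ¬? (v ∈? C)))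
    ... | no none = record
      { C = C ; C⊆T = C⊆T ; x∈C = x∈C ; closed = closed
      ; connected = λ u∈ v∈ → reverse Within-sym (reach u∈) ◅◅ reach v∈ }
      where
      closed : ∀ {u v} → u ∈ C → v ∈ T → u ~ v → v ∈ C
      closed {u} {v} u∈ v∈T u~v with v ∈? C
      ... | yes v∈ = v∈
      ... | no v∉ = contradiction (v , u , u∈ , v∈T , u~v , v∉) none
    ... | yes (v , u , u∈ , v∈T , u~v , v∉) =
      grow C′ (rec (C⊆C′ , v , v∈C′ , v∉)) (C⊆C′ x∈C) C′⊆T reach′
      where
      C′ = C ∪ ⁅ v ⁆
      C⊆C′ : C ⊆ C′
      C⊆C′ = p⊆p∪q ⁅ v ⁆
      v∈C′ : v ∈ C′
      v∈C′ = q⊆p∪q C ⁅ v ⁆ (x∈⁅x⁆ v)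
      C′⊆T : C′ ⊆ T
      C′⊆T w∈ with x∈p∪q⁻ C ⁅ v ⁆ w∈
      ... | inj₁ w∈C = C⊆T w∈C
      ... | inj₂ w∈v = subst (_∈ T) (sym (x∈⁅y⁆⇒x≡y v w∈v)) v∈T
      lift : ∀ {s t} → Within C s t → Within C′ s t
      lift (s∈ , t∈ , s~t) = C⊆C′ s∈ , C⊆C′ t∈ , s~t
      reach′ : ∀ {w} → w ∈ C′ → Star (Within C′) x w
      reach′ w∈ with x∈p∪q⁻ C ⁅ v ⁆ w∈
      ... | inj₁ w∈C = map lift (reach w∈C)
      ... | inj₂ w∈v rewrite x∈⁅y⁆⇒x≡y v w∈v =
        map lift (reach u∈) ◅◅ return (C⊆C′ u∈ , v∈C′ , u~v)

-- Induced paths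

module Paths (G : Graph) where
  open Adjacency G

  Unrelated : V → V → Set
  Unrelated u x = u ≢ x × u ≁ x

  data InducedPath : V → List V → Set where
    end  : ∀ {u} → InducedPath u []
    step : ∀ {u v l} → u ~ v → All (Unrelated u) l → InducedPath v l → InducedPath u (v ∷ l)

  -- The boolean is the successor clause in the adjacency of `Cycle`, so that a path can be inserted
  -- into a cycle directly.
  path-lookup : ∀ {u l} → InducedPath u l → ∀ i j → i Fin.< j →
                lookup (u ∷ l) i ≢ lookup (u ∷ l) j ×
                (toℕ j ≡ᵇ ℕ.suc (toℕ i)) ≡ adj G (lookup (u ∷ l) i) (lookup (u ∷ l) j)
  path-lookup (step uv non p) zero (suc zero) _ = ~⇒≢ uv , sym uv
  path-lookup (step {l = l} uv non p) zero (suc (suc j)) _ with All.lookup non (∈-lookup {xs = l} j)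
  ... | u≢x , u≁x = u≢x , sym (≁⇒false u≁x)
  path-lookup (step uv non p) (suc i) (suc j) (s≤s i<j) = path-lookup p i j i<j

  ¬<-≡ᵇ : ∀ {i j} → i ℕ.< j → (i ≡ᵇ ℕ.suc j) ≡ false
  ¬<-≡ᵇ {ℕ.zero}  _ = refl
  ¬<-≡ᵇ {ℕ.suc i} (s<s i<j) = ¬<-≡ᵇ i<j

  module _ (C : Subset (n G)) (r b : V) (r∉C : r ∉ C) where

    -- The last vertex is the only neighbour of r, and it equals or is adjacent to b.
    data PathTo : V → List V → Set where
      last : ∀ {u} → u ∈ C → u ~ r → u ≡ b ⊎ u ~ b → PathTo u []
      cons : ∀ {u v l} → u ∈ C → u ≁ r → u ~ v → All (Unrelated u) l → PathTo v l →
             PathTo u (v ∷ l)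

    ∈C⇒≢r : ∀ {u} → u ∈ C → r ≢ u
    ∈C⇒≢r u∈ refl = r∉C u∈

    PathTo⇒InducedPath : ∀ {u l} → PathTo u l → InducedPath u l
    PathTo⇒InducedPath (last _ _ _) = end
    PathTo⇒InducedPath (cons _ _ uv non p) = step uv non (PathTo⇒InducedPath p)

    PathTo-adj : ∀ {u l} → PathTo u l → ∀ i →
                 r ≢ lookup (u ∷ l) i × (toℕ i ≡ᵇ length l) ≡ adj G r (lookup (u ∷ l) i)
    PathTo-adj (last u∈ ur _) zero = ∈C⇒≢r u∈ , sym (~-sym ur)
    PathTo-adj (cons u∈ u≁r _ _ _) zero = ∈C⇒≢r u∈ , sym (≁⇒false (≁-sym u≁r))
    PathTo-adj (cons _ _ _ _ p) (suc i) = PathTo-adj p i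

    -- The search runs from the far end, so `w` is the last vertex of the path that equals or sees
    -- `u`. Dropping everything before `w` keeps the path induced when `u` is prepended.
    shortcut : ∀ u {v l} → PathTo v l →
               All (Unrelated u) (v ∷ l) ⊎
               ∃₂ λ w l′ → PathTo w l′ × (u ≡ w ⊎ (u ~ w × All (Unrelated u) l′))
    shortcut u {v} {l} p with tail p
      where
      tail : ∀ {v l} → PathTo v l → All (Unrelated u) l ⊎
             ∃₂ λ w l′ → PathTo w l′ × (u ≡ w ⊎ (u ~ w × All (Unrelated u) l′))
      tail (last _ _ _) = inj₁ []
      tail (cons _ _ _ _ p) = shortcut u p
    ... | inj₂ found = inj₂ found
    ... | inj₁ non with u ≟ v | u ~? v
    ...   | yes u≡v | _       = inj₂ (v , l , p , inj₁ u≡v)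
    ...   | no _    | yes u~v = inj₂ (v , l , p , inj₂ (u~v , non))
    ...   | no u≢v  | no u≁v  = inj₁ ((u≢v , u≁v) ∷ non)

    module _ (chordal : Chordal G) where

      no-long-cycle : ∀ {u v w l} → u ∈ C → u ~ r → u ~ v → All (Unrelated u) (w ∷ l) →
                      ¬ PathTo v (w ∷ l)
      no-long-cycle {u} {v} {w} {l} u∈ ur uv non p =
        chordal (length l) (induced (Cycle (length l)) G f ok)
        where
        f : Fin (4 ℕ.+ length l) → V
        -- Vertex 0 of the cycle is `r`, whose only neighbours on it are `u` and the last vertex of
        -- the path.
        f = lookup (r ∷ u ∷ v ∷ w ∷ l)
        ok : ∀ i j → i Fin.< j → f i ≢ f j × adj (Cycle (length l)) i j ≡ adj G (f i) (f j)
        ok zero (suc zero) _ = ∈C⇒≢r u∈ , sym (~-sym ur)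
        ok zero (suc (suc j)) _ with PathTo-adj p j
        ... | r≢ , eq = r≢ , trans (∨-identityʳ _) eq
        ok (suc i) (suc j) (s≤s i<j) with path-lookup (step uv non (PathTo⇒InducedPath p)) i j i<j
        ... | x≢y , eq = x≢y , trans (cong₂ _∨_ (∨-identityʳ (toℕ j ≡ᵇ ℕ.suc (toℕ i)))
                           (trans (∨-identityʳ (toℕ i ≡ᵇ ℕ.suc (toℕ j))) (¬<-≡ᵇ i<j)))
                           (trans (∨-identityʳ _) eq)

  DiamondFree : Subset (n G) → Set
  DiamondFree S = ∀ {v b a c} → v ∈ S → b ∈ S → a ∈ S → c ∈ S →
                  v ~ b → a ~ v → a ~ b → c ~ v → c ~ b → a ≢ c → a ~ c

  module _ (chordal : Chordal G) {S C : Subset (n G)} (diamond-free : DiamondFree S)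
           (C⊆S : C ⊆ S) {r : V} (r∈S : r ∈ S) (r∉C : r ∉ C) where

    -- Induction along the walk: `u` is put in front of the path obtained for the next vertex, after
    -- shortcutting. If `u` sees `r`, the path has to shrink to `u` alone. A remainder of two or
    -- more vertices would close a long induced cycle through `r`. A single vertex `w` is `b` itself
    -- or forms with `r` the middle edge of a would-be diamond with tips `u` and `b`, so `u` equals
    -- or sees `b`.
    pathTo : ∀ {u b} → b ~ r → u ∈ C → b ∈ C → Star (Within C) u b → ∃ (PathTo C r b r∉C u)
    pathTo br u∈ b∈ ε = [] , last u∈ br (inj₁ refl)
    pathTo {u} {b} br u∈ b∈ ((_ , v∈ , uv) ◅ walk) with pathTo br v∈ b∈ walk
    ... | l , p with shortcut C r b r∉C u p
    ... | inj₁ ((_ , u≁v) ∷ _) = contradiction uv u≁v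
    ... | inj₂ (w , l′ , q , inj₁ refl) = l′ , q
    ... | inj₂ (w , l′ , q , inj₂ (uw , non)) with u ~? r
    ...   | no u≁r = w ∷ l′ , cons u∈ u≁r uw non q
    ...   | yes ur with q
    ...     | cons _ _ _ _ _ = contradiction q (no-long-cycle C r b r∉C chordal u∈ ur uw non)
    ...     | last _ _ (inj₁ refl) = [] , last u∈ ur (inj₂ uw)
    ...     | last w∈ wr (inj₂ wb) with u ≟ b
    ...       | yes u≡b = [] , last u∈ ur (inj₁ u≡b)
    ...       | no u≢b  = [] , last u∈ ur (inj₂
                  (diamond-free r∈S (C⊆S w∈) (C⊆S u∈) (C⊆S b∈) (~-sym wr) ur uw br (~-sym wb) u≢b))

    -- Only the last vertex of the path from `pathTo` sees `r`, so a path starting at `a` stops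
    -- there, and `a` equals or sees `b`.
    neighbours-adjacent : ∀ {a b} → a ∈ C → b ∈ C → Star (Within C) a b → a ~ r → b ~ r → a ≢ b → a ~ b
    neighbours-adjacent a∈ b∈ walk ar br a≢b with pathTo br a∈ b∈ walk
    ... | _ , last _ _ (inj₁ a≡b) = contradiction a≡b a≢b
    ... | _ , last _ _ (inj₂ ab) = ab
    ... | _ , cons _ a≁r _ _ _ = contradiction ar a≁r

-- Two-labelled constructions and their 4-expressions

module TwoLabelled (G : Graph) where
  open Adjacency G using (V)

  -- In a join, c = nothing keeps the labels of a part and c = just b turns them all into b.
  data Built : Subset (n G) → (V → Bool) → Set where
    empty  : ∀ {S l} → Empty S → Built S l
    single : ∀ {S l v} → v ∈ S → (∀ {u} → u ∈ S → u ≡ v) → Built S l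
    join   : ∀ {S T W l₁ l₂ l} → Built S l₁ → Built T l₂ →
             (R : Bool → Bool → Bool) (c₁ c₂ : Maybe Bool) →
             S ⊆ W → T ⊆ W → (∀ {v} → v ∈ W → v ∈ S ⊎ v ∈ T) →
             (∀ {v} → v ∈ S → v ∉ T) →
             (∀ {u v} → u ∈ S → v ∈ T → adj G u v ≡ R (l₁ u) (l₂ v)) →
             (∀ {v} → v ∈ S → l v ≡ fromMaybe (l₁ v) c₁) →
             (∀ {v} → v ∈ T → l v ≡ fromMaybe (l₂ v) c₂) →
             Built W l

  left right : Bool → Fin 4
  left false = 0F
  left true  = 1F
  right false = 2F
  right true  = 3F

  toRight : ∀ {a} → Expr 4 a → Expr 4 a
  toRight e = ρ 1F 3F (ρ 0F 2F e)

  merge : ∀ {a} → Maybe Bool → Expr 4 a → Expr 4 a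
  merge nothing      e = e
  merge (just false) e = ρ 1F 0F e
  merge (just true)  e = ρ 0F 1F e

  toLeft : ∀ {a} → Maybe Bool → Expr 4 a → Expr 4 a
  toLeft c e = ρ 3F (left (fromMaybe true c)) (ρ 2F (left (fromMaybe false c)) e)

  η? : ∀ {a} → Bool → (i j : Fin 4) → i ≢ j → Expr 4 a → Expr 4 a
  η? false i j i≢j e = e
  η? true  i j i≢j e = η i j i≢j e

  cross : ∀ {a} → (Bool → Bool → Bool) → Expr 4 a → Expr 4 a
  cross R e =
    η? (R false false) 0F 2F (λ ()) (η? (R false true) 0F 3F (λ ())
      (η? (R true false) 1F 2F (λ ()) (η? (R true true) 1F 3F (λ ()) e)))

  module _ {a : ℕ} (e : Expr 4 a) {x : Fin a} where

    label-merge : ∀ c {b} → label e x ≡ left b → label (merge c e) x ≡ left (fromMaybe b c)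
    label-merge nothing      p = p
    label-merge (just false) {false} p rewrite p = refl
    label-merge (just false) {true}  p rewrite p = refl
    label-merge (just true)  {false} p rewrite p = refl
    label-merge (just true)  {true}  p rewrite p = refl

    label-merge-right : ∀ c {b} → label e x ≡ right b → label (merge c e) x ≡ right b
    label-merge-right nothing      p = p
    label-merge-right (just false) {false} p rewrite p = refl
    label-merge-right (just false) {true}  p rewrite p = refl
    label-merge-right (just true)  {false} p rewrite p = refl
    label-merge-right (just true)  {true}  p rewrite p = refl

    label-toRight : ∀ {b} → label e x ≡ left b → label (toRight e) x ≡ right b
    label-toRight {false} p rewrite p = refl
    label-toRight {true}  p rewrite p = refl

    label-toLeft : ∀ c {b} → label e x ≡ right b → label (toLeft c e) x ≡ left (fromMaybe b c)
    label-toLeft nothing {false} p rewrite p = refl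
    label-toLeft nothing {true}  p rewrite p = refl
    label-toLeft (just false) {false} p rewrite p = refl
    label-toLeft (just false) {true}  p rewrite p = refl
    label-toLeft (just true)  {false} p rewrite p = refl
    label-toLeft (just true)  {true}  p rewrite p = refl

    label-toLeft-left : ∀ c {b} → label e x ≡ left b → label (toLeft c e) x ≡ left b
    label-toLeft-left c {false} p rewrite p = refl
    label-toLeft-left c {true}  p rewrite p = refl

  label-η? : ∀ {a} r i j i≢j (e : Expr 4 a) x → label (η? r i j i≢j e) x ≡ label e x
  label-η? false i j i≢j e x = refl
  label-η? true  i j i≢j e x = refl

  label-cross : ∀ {a} R (e : Expr 4 a) x → label (cross R e) x ≡ label e x
  label-cross R e x =
    trans (label-η? (R false false) _ _ _ _ x) (trans (label-η? (R false true) _ _ _ _ x)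
      (trans (label-η? (R true false) _ _ _ _ x) (label-η? (R true true) _ _ _ e x)))

  linked : Bool → (i j p q : Fin 4) → Bool
  linked r i j p q = ((does (p ≟ i) ∧ does (q ≟ j)) ∨ (does (p ≟ j) ∧ does (q ≟ i))) ∧ r

  eadj-η? : ∀ {a} r i j i≢j (e : Expr 4 a) x y →
            eadj (η? r i j i≢j e) x y ≡ linked r i j (label e x) (label e y) ∨ eadj e x y
  eadj-η? false i j i≢j e x y = sym (cong (_∨ eadj e x y) (∧-zeroʳ _))
  eadj-η? true  i j i≢j e x y =
    trans (∨-comm (eadj e x y) _) (sym (cong (_∨ eadj e x y) (∧-identityʳ _)))

  -- The adjacency after `cross` as a function of the former adjacency `b` and the two labels; for
  -- concrete labels it is settled by computation.
  crossing : (Bool → Bool → Bool) → Bool → (p q : Fin 4) → Bool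
  crossing R b p q =
    linked (R false false) 0F 2F p q ∨ (linked (R false true) 0F 3F p q ∨
      (linked (R true false) 1F 2F p q ∨ (linked (R true true) 1F 3F p q ∨ b)))

  eadj-cross : ∀ {a} R (e : Expr 4 a) x y →
               eadj (cross R e) x y ≡ crossing R (eadj e x y) (label e x) (label e y)
  eadj-cross R e x y =
    step (R false false) _ _ (λ ()) e₃ (lab₃ x) (lab₃ y)
      (step (R false true) _ _ (λ ()) e₂ (lab₂ x) (lab₂ y)
        (step (R true false) _ _ (λ ()) e₁ (lab₁ x) (lab₁ y)
          (step (R true true) _ _ (λ ()) e refl refl refl)))
    where
    e₁ = η? (R true true) 1F 3F (λ ()) e
    e₂ = η? (R true false) 1F 2F (λ ()) e₁
    e₃ = η? (R false true) 0F 3F (λ ()) e₂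
    lab₁ : ∀ z → label e₁ z ≡ label e z
    lab₁ = label-η? (R true true) _ _ _ e
    lab₂ : ∀ z → label e₂ z ≡ label e z
    lab₂ z = trans (label-η? (R true false) _ _ _ e₁ z) (lab₁ z)
    lab₃ : ∀ z → label e₃ z ≡ label e z
    lab₃ z = trans (label-η? (R false true) _ _ _ e₂ z) (lab₂ z)
    step : ∀ r i j i≢j f {p q b} → label f x ≡ p → label f y ≡ q → eadj f x y ≡ b →
           eadj (η? r i j i≢j f) x y ≡ linked r i j p q ∨ b
    step r i j i≢j f refl refl refl = eadj-η? r i j i≢j f x y

  module _ (R : Bool → Bool → Bool) where

    crossing-left : ∀ b p q → crossing R b (left p) (left q) ≡ b
    crossing-left b false false = refl
    crossing-left b false true  = refl
    crossing-left b true  false = refl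
    crossing-left b true  true  = refl

    crossing-right : ∀ b p q → crossing R b (right p) (right q) ≡ b
    crossing-right b false false = refl
    crossing-right b false true  = refl
    crossing-right b true  false = refl
    crossing-right b true  true  = refl

    crossing-left-right : ∀ p q → crossing R false (left p) (right q) ≡ R p q
    crossing-left-right false false = ∨-identityʳ _
    crossing-left-right false true  = ∨-identityʳ _
    crossing-left-right true  false = ∨-identityʳ _
    crossing-left-right true  true  = ∨-identityʳ _

    crossing-right-left : ∀ p q → crossing R false (right q) (left p) ≡ R p q
    crossing-right-left false false = ∨-identityʳ _
    crossing-right-left false true  = ∨-identityʳ _
    crossing-right-left true  false = ∨-identityʳ _
    crossing-right-left true  true  = ∨-identityʳ _

  -- A bijection between `S` and the vertices of the expression; `idx` is total for convenience, and
  -- its values outside `S` carry no meaning. Only the labels `0F` and `1F` remain in use on `S`.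
  record Realized (S : Subset (n G)) (l : V → Bool) : Set where
    field
      size    : ℕ
      expr    : Expr 4 size
      idx     : V → Fin size
      inv     : Fin size → V
      inv∈    : ∀ i → inv i ∈ S
      idx∘inv : ∀ i → idx (inv i) ≡ i
      inv∘idx : ∀ {v} → v ∈ S → inv (idx v) ≡ v
      adj≡    : ∀ {u v} → u ∈ S → v ∈ S → adj G u v ≡ eadj expr (idx u) (idx v)
      label≡  : ∀ {v} → v ∈ S → label expr (idx v) ≡ left (l v)
  open Realized

  eadj-merge : ∀ {a} c (e : Expr 4 a) x y → eadj (merge c e) x y ≡ eadj e x y
  eadj-merge nothing      e x y = refl
  eadj-merge (just false) e x y = refl
  eadj-merge (just true)  e x y = refl

  relabel : ∀ {S T l l′} (c : Maybe Bool) → S ⊆ T → T ⊆ S →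
            (∀ {v} → v ∈ S → l′ v ≡ fromMaybe (l v) c) → Realized S l → Realized T l′
  relabel c S⊆T T⊆S l≡ r = record
    { size    = size r
    ; expr    = merge c (expr r)
    ; idx     = idx r
    ; inv     = inv r
    ; inv∈    = λ i → S⊆T (inv∈ r i)
    ; idx∘inv = idx∘inv r
    ; inv∘idx = λ v∈ → inv∘idx r (T⊆S v∈)
    ; adj≡    = λ u∈ v∈ → trans (adj≡ r (T⊆S u∈) (T⊆S v∈)) (sym (eadj-merge c (expr r) _ _))
    ; label≡  = λ v∈ → trans (label-merge (expr r) c (label≡ r (T⊆S v∈)))
                         (cong left (sym (l≡ (T⊆S v∈))))
    }

  module _ {S T W : Subset (n G)} {l₁ l₂ l : V → Bool}
           (R : Bool → Bool → Bool) (c₁ c₂ : Maybe Bool)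
           (S⊆W : S ⊆ W) (T⊆W : T ⊆ W) (split : ∀ {v} → v ∈ W → v ∈ S ⊎ v ∈ T)
           (disjoint : ∀ {v} → v ∈ S → v ∉ T)
           (adj-R : ∀ {u v} → u ∈ S → v ∈ T → adj G u v ≡ R (l₁ u) (l₂ v))
           (l≡₁ : ∀ {v} → v ∈ S → l v ≡ fromMaybe (l₁ v) c₁)
           (l≡₂ : ∀ {v} → v ∈ T → l v ≡ fromMaybe (l₂ v) c₂)
           (r : Realized S l₁) (s : Realized T l₂) where
    private
      a b : ℕ
      a = size r
      b = size s

      base joined final : Expr 4 (a ℕ.+ b)
      base   = expr r ⊕ toRight (expr s)
      joined = cross R base
      -- The left part is merged first, while the right part still carries `2F` and `3F` and so is
      -- not affected; only then does the right part move to `0F` and `1F`.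
      final  = toLeft c₂ (merge c₁ joined)

      index : V → Fin (a ℕ.+ b)
      index v with v ∈? S
      ... | yes _ = idx r v ↑ˡ b
      ... | no  _ = a ↑ʳ idx s v

      index-S : ∀ {v} → v ∈ S → index v ≡ idx r v ↑ˡ b
      index-S {v} v∈ with v ∈? S
      ... | yes _ = refl
      ... | no v∉ = contradiction v∈ v∉

      index-T : ∀ {v} → v ∈ T → index v ≡ a ↑ʳ idx s v
      index-T {v} v∈ with v ∈? S
      ... | yes v∈S = contradiction v∈ (disjoint v∈S)
      ... | no _ = refl

      inverse : Fin (a ℕ.+ b) → V
      inverse i = [ inv r , inv s ]′ (splitAt a i)

      inverse∈ : ∀ i → inverse i ∈ W
      inverse∈ i with splitAt a i
      ... | inj₁ j = S⊆W (inv∈ r j)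
      ... | inj₂ j = T⊆W (inv∈ s j)

      index∘inverse : ∀ i → index (inverse i) ≡ i
      index∘inverse i with splitAt a i in eq
      ... | inj₁ j = trans (index-S (inv∈ r j))
                       (trans (cong (_↑ˡ b) (idx∘inv r j)) (splitAt⁻¹-↑ˡ eq))
      ... | inj₂ j = trans (index-T (inv∈ s j))
                       (trans (cong (a ↑ʳ_) (idx∘inv s j)) (splitAt⁻¹-↑ʳ eq))

      inverse∘index : ∀ {v} → v ∈ W → inverse (index v) ≡ v
      inverse∘index {v} v∈ with split v∈
      ... | inj₁ v∈S rewrite index-S v∈S | splitAt-↑ˡ a (idx r v) b = inv∘idx r v∈S
      ... | inj₂ v∈T rewrite index-T v∈T | splitAt-↑ʳ a b (idx s v) = inv∘idx s v∈T

      label-S : ∀ {v} → v ∈ S → label base (index v) ≡ left (l₁ v)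
      label-S {v} v∈S rewrite index-S v∈S | splitAt-↑ˡ a (idx r v) b = label≡ r v∈S

      label-T : ∀ {v} → v ∈ T → label base (index v) ≡ right (l₂ v)
      label-T {v} v∈T rewrite index-T v∈T | splitAt-↑ʳ a b (idx s v) =
        label-toRight (expr s) (label≡ s v∈T)

      final-label : ∀ {v} → v ∈ W → label final (index v) ≡ left (l v)
      final-label {v} v∈ with split v∈
      ... | inj₁ v∈S = trans (label-toLeft-left (merge c₁ joined) c₂
                         (label-merge joined c₁ (trans (label-cross R base (index v)) (label-S v∈S))))
                         (cong left (sym (l≡₁ v∈S)))
      ... | inj₂ v∈T = trans (label-toLeft (merge c₁ joined) c₂
                         (label-merge-right joined c₁ (trans (label-cross R base (index v)) (label-T v∈T))))
                         (cong left (sym (l≡₂ v∈T)))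

      base-SS : ∀ {u v} → u ∈ S → v ∈ S → adj G u v ≡ eadj base (index u) (index v)
      base-SS {u} {v} u∈ v∈
        rewrite index-S u∈ | index-S v∈ | splitAt-↑ˡ a (idx r u) b | splitAt-↑ˡ a (idx r v) b
        = adj≡ r u∈ v∈

      base-TT : ∀ {u v} → u ∈ T → v ∈ T → adj G u v ≡ eadj base (index u) (index v)
      base-TT {u} {v} u∈ v∈
        rewrite index-T u∈ | index-T v∈ | splitAt-↑ʳ a b (idx s u) | splitAt-↑ʳ a b (idx s v)
        = adj≡ s u∈ v∈

      base-ST : ∀ {u v} → u ∈ S → v ∈ T → eadj base (index u) (index v) ≡ false
      base-ST {u} {v} u∈ v∈
        rewrite index-S u∈ | index-T v∈ | splitAt-↑ˡ a (idx r u) b | splitAt-↑ʳ a b (idx s v) = refl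

      base-TS : ∀ {u v} → u ∈ T → v ∈ S → eadj base (index u) (index v) ≡ false
      base-TS {u} {v} u∈ v∈
        rewrite index-T u∈ | index-S v∈ | splitAt-↑ʳ a b (idx s u) | splitAt-↑ˡ a (idx r v) b = refl

      crossed : ∀ u v {p q c} → label base (index u) ≡ p → label base (index v) ≡ q →
                eadj base (index u) (index v) ≡ c →
                eadj joined (index u) (index v) ≡ crossing R c p q
      crossed u v refl refl refl = eadj-cross R base _ _

      joined-adj : ∀ {u v} → u ∈ W → v ∈ W → adj G u v ≡ eadj joined (index u) (index v)
      joined-adj {u} {v} u∈ v∈ with split u∈ | split v∈
      ... | inj₁ p | inj₁ q =
        trans (base-SS p q) (sym (trans (crossed u v (label-S p) (label-S q) refl)
          (crossing-left R _ (l₁ u) (l₁ v))))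
      ... | inj₂ p | inj₂ q =
        trans (base-TT p q) (sym (trans (crossed u v (label-T p) (label-T q) refl)
          (crossing-right R _ (l₂ u) (l₂ v))))
      ... | inj₁ p | inj₂ q =
        trans (adj-R p q) (sym (trans (crossed u v (label-S p) (label-T q) (base-ST p q))
          (crossing-left-right R (l₁ u) (l₂ v))))
      ... | inj₂ p | inj₁ q =
        trans (adj-sym G u v) (trans (adj-R q p)
          (sym (trans (crossed u v (label-T p) (label-S q) (base-TS p q))
            (crossing-right-left R (l₁ v) (l₂ u)))))

    realize-join : Realized W l
    realize-join = record
      { size = a ℕ.+ b ; expr = final ; idx = index ; inv = inverse ; inv∈ = inverse∈
      ; idx∘inv = index∘inverse ; inv∘idx = inverse∘index
      ; adj≡ = λ {u} {v} u∈ v∈ →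
          trans (joined-adj u∈ v∈) (sym (eadj-merge c₁ joined (index u) (index v)))
      ; label≡ = final-label }

  -- Every expression has at least one vertex, so the empty set needs an alternative of its own; a
  -- join with one empty part merely relabels the other part.
  realize : ∀ {S l} → Built S l → Empty S ⊎ Realized S l
  realize (empty ∅) = inj₁ ∅
  realize {S} {l} (single {v = v} v∈ only) = inj₂ record
    { size = 1 ; expr = vtx (left (l v)) ; idx = λ _ → zero ; inv = λ _ → v ; inv∈ = λ _ → v∈
    ; idx∘inv = λ { zero → refl } ; inv∘idx = λ u∈ → sym (only u∈)
    ; adj≡ = λ {u} {w} u∈ w∈ →
        trans (cong₂ (adj G) (only u∈) (only w∈)) (adj-irrefl G v)
    ; label≡ = λ u∈ → cong (λ w → left (l w)) (sym (only u∈)) }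
  realize (join p q R c₁ c₂ S⊆ T⊆ split disj adj-R l≡₁ l≡₂) with realize p | realize q
  ... | inj₁ ∅ | inj₁ ∅′ = inj₁ λ (v , v∈) →
    [ (λ v∈ → ∅ (v , v∈)) , (λ v∈ → ∅′ (v , v∈)) ]′ (split v∈)
  ... | inj₁ ∅ | inj₂ s =
    inj₂ (relabel c₂ T⊆ (λ v∈ → [ (λ v∈ → contradiction (_ , v∈) ∅) , (λ v∈ → v∈) ]′ (split v∈)) l≡₂ s)
  ... | inj₂ r | inj₁ ∅ =
    inj₂ (relabel c₁ S⊆ (λ v∈ → [ (λ v∈ → v∈) , (λ v∈ → contradiction (_ , v∈) ∅) ]′ (split v∈)) l≡₁ r)
  ... | inj₂ r | inj₂ s = inj₂ (realize-join R c₁ c₂ S⊆ T⊆ split disj adj-R l≡₁ l≡₂ r s)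

  Built⇒CliqueWidth≤4 : ∀ {l} → Built ⊤ l → CliqueWidth≤ 4 G
  Built⇒CliqueWidth≤4 p with realize p
  ... | inj₁ ∅ = inj₁ (no-vertices ∅)
    where
    no-vertices : ∀ {m} → Empty (⊤ {m}) → m ≡ 0
    no-vertices {ℕ.zero}  _ = refl
    no-vertices {ℕ.suc m} ∅ = contradiction (zero , ∈⊤) ∅
  ... | inj₂ r = fit size≡n (expr r) (idx r) idx-injective (λ x y → adj≡ r ∈⊤ ∈⊤)
    where
    idx-injective : ∀ {x y} → idx r x ≡ idx r y → x ≡ y
    idx-injective eq = trans (sym (inv∘idx r ∈⊤)) (trans (cong (inv r) eq) (inv∘idx r ∈⊤))
    inv-injective : ∀ {x y} → inv r x ≡ inv r y → x ≡ y
    inv-injective eq = trans (sym (idx∘inv r _)) (trans (cong (idx r) eq) (idx∘inv r _))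
    size≡n : size r ≡ n G
    size≡n = ℕ.≤-antisym (injective⇒≤ inv-injective) (injective⇒≤ idx-injective)
    -- The size is generalized to a variable so that its equation with `n G` can be matched.
    fit : ∀ {a} → a ≡ n G → (e : Expr 4 a) (f : V → Fin a) → (∀ {x y} → f x ≡ f y → x ≡ y) →
          (∀ x y → adj G x y ≡ eadj e (f x) (f y)) → CliqueWidth≤ 4 G
    fit refl e f f-inj f-adj = inj₂ (e , f , f-inj , f-adj)

-- Diamond-free chordal graphs

module Build (G : Graph) where
  open TwoLabelled G
  open Adjacency G
  open Paths G

  -- A join with the empty set can change labels and replace `S` by a set with the same elements.
  recast : ∀ {S W l l′} → Built S l → (c : Maybe Bool) → S ⊆ W → W ⊆ S →
           (∀ {v} → v ∈ S → l′ v ≡ fromMaybe (l v) c) → Built W l′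
  recast {l′ = l′} p c S⊆W W⊆S l≡ =
    join p (empty {⊥} {l′} λ (_ , v∈) → ∉⊥ v∈) (λ _ _ → false) c nothing S⊆W
      (λ v∈ → contradiction v∈ ∉⊥) (λ v∈ → inj₁ (W⊆S v∈)) (λ _ → ∉⊥)
      (λ _ v∈ → contradiction v∈ ∉⊥) l≡ (λ _ → refl)

  recolour : ∀ {S l} c → Built S l → Built S (λ _ → c)
  recolour c p = recast p (just c) id id (λ _ → refl)

  adj≡does : ∀ {u v} {A : Set} (a? : Dec A) → (u ~ v → A) → (A → u ~ v) → adj G u v ≡ does a?
  adj≡does {u} {v} a? f g = trans (sym does-~?) (does-⇔ (mk⇔ f g) (u ~? v) a?)
    where
    does-~? : does (u ~? v) ≡ adj G u v
    does-~? with adj G u v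
    ... | true = refl
    ... | false = refl

  member : Subset (n G) → V → Bool
  member Q v = does (v ∈? Q)

  member-cong : ∀ {P Q v} → (v ∈ P → v ∈ Q) → (v ∈ Q → v ∈ P) → member P v ≡ member Q v
  member-cong {P} {Q} {v} f g = does-⇔ (mk⇔ f g) (v ∈? P) (v ∈? Q)

  opaque
    _∖_ : Subset (n G) → Subset (n G) → Subset (n G)
    S ∖ C = sep (λ v → v ∈? S ×-dec ¬? (v ∈? C))

    ∖⁺ : ∀ {S C v} → v ∈ S → v ∉ C → v ∈ S ∖ C
    ∖⁺ {S} {C} v∈ v∉ = ∈sep⁺ (λ v → v ∈? S ×-dec ¬? (v ∈? C)) (v∈ , v∉)

    ∖⁻ : ∀ {S C v} → v ∈ S ∖ C → v ∈ S × v ∉ C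
    ∖⁻ {S} {C} = ∈sep⁻ (λ v → v ∈? S ×-dec ¬? (v ∈? C))

  ∖-split : ∀ S C {v} → v ∈ S → v ∈ S ∖ C ⊎ v ∈ C
  ∖-split S C {v} v∈ with v ∈? C
  ... | yes v∈C = inj₂ v∈C
  ... | no v∉C = inj₁ (∖⁺ v∈ v∉C)

  -- In a diamond-free set these are the maximal cliques and the cliques of size at most one.
  record GoodClique (S Q : Subset (n G)) : Set where
    field
      Q⊆S    : Q ⊆ S
      clique : ∀ {u v} → u ∈ Q → v ∈ Q → u ≢ v → u ~ v
      few    : ∀ {x u v} → x ∈ S → x ∉ Q → u ∈ Q → v ∈ Q → x ~ u → x ~ v → u ≡ v

  singleton-good : ∀ {S r} → r ∈ S → GoodClique S ⁅ r ⁆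
  singleton-good {r = r} r∈ = record
    { Q⊆S = λ v∈ → subst (_∈ _) (sym (x∈⁅y⁆⇒x≡y r v∈)) r∈
    ; clique = λ u∈ v∈ u≢v → contradiction (trans (x∈⁅y⁆⇒x≡y r u∈) (sym (x∈⁅y⁆⇒x≡y r v∈))) u≢v
    ; few = λ _ _ u∈ v∈ _ _ → trans (x∈⁅y⁆⇒x≡y r u∈) (sym (x∈⁅y⁆⇒x≡y r v∈)) }

  module _ (chordal : Chordal G) where

    module BlockStep {S Q : Subset (n G)} (diamond-free : DiamondFree S) (good : GoodClique S Q)
                     {r x : V} (r∈Q : r ∈ Q) (x∈S : x ∈ S) (x≢r : x ≢ r) where
      open GoodClique good

      r∈S : r ∈ S
      r∈S = Q⊆S r∈Q

      open Component (component (S ∖ ⁅ r ⁆) (∖⁺ x∈S (λ x∈ → x≢r (x∈⁅y⁆⇒x≡y r x∈))))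

      C⊆S : C ⊆ S
      C⊆S v∈ = proj₁ (∖⁻ (C⊆T v∈))

      r∉C : r ∉ C
      r∉C r∈ = proj₂ (∖⁻ (C⊆T r∈)) (x∈⁅x⁆ r)

      C≢r : ∀ {v} → v ∈ C → v ≢ r
      C≢r v∈ refl = r∉C v∈

      closed′ : ∀ {u v} → u ∈ C → v ∈ S → v ≢ r → u ~ v → v ∈ C
      closed′ u∈ v∈ v≢r = closed u∈ (∖⁺ v∈ (λ v∈r → v≢r (x∈⁅y⁆⇒x≡y r v∈r)))

      K? : ∀ v → Dec (v ∈ C × v ~ r)
      K? v = v ∈? C ×-dec v ~? r

      K : Subset (n G)
      K = sep K?

      K⁻ : ∀ {v} → v ∈ K → v ∈ C × v ~ r
      K⁻ = ∈sep⁻ K?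

      K⁺ : ∀ {v} → v ∈ C → v ~ r → v ∈ K
      K⁺ v∈ vr = ∈sep⁺ K? (v∈ , vr)

      K-clique : ∀ {u v} → u ∈ K → v ∈ K → u ≢ v → u ~ v
      K-clique u∈ v∈ with K⁻ u∈ | K⁻ v∈
      ... | u∈C , ur | v∈C , vr =
        neighbours-adjacent chordal diamond-free C⊆S r∈S r∉C u∈C v∈C (connected u∈C v∈C) ur vr

      K-good : GoodClique C K
      K-good = record { Q⊆S = λ v∈ → proj₁ (K⁻ v∈) ; clique = K-clique ; few = K-few }
        where
        K-few : ∀ {y u v} → y ∈ C → y ∉ K → u ∈ K → v ∈ K → y ~ u → y ~ v → u ≡ v
        K-few {y} {u} {v} y∈ y∉ u∈ v∈ yu yv with u ≟ v
        ... | yes u≡v = u≡v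
        ... | no u≢v with K⁻ u∈ | K⁻ v∈
        -- If `y` saw both `u` and `v`, these would be the middle of a diamond with tips `y` and
        -- `r`, unless `y ~ r`, that is, `y ∈ K`.
        ... | u∈C , ur | v∈C , vr = contradiction (K⁺ y∈
              (diamond-free (C⊆S u∈C) (C⊆S v∈C) (C⊆S y∈) r∈S
                (K-clique u∈ v∈ u≢v) yu yv (~-sym ur) (~-sym vr) (C≢r y∈))) y∉

      Q∩C⊆K : ∀ {v} → v ∈ C → v ∈ Q → v ∈ K
      Q∩C⊆K v∈C v∈Q = K⁺ v∈C (clique v∈Q r∈Q (C≢r v∈C))

      -- A vertex of `K` outside `Q` would see the two vertices `x` and `r` of the good clique `Q`.
      K⊆Q : x ∈ Q → ∀ {v} → v ∈ K → v ∈ Q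
      K⊆Q x∈Q {v} v∈ with v ∈? Q | K⁻ v∈
      ... | yes v∈Q | _ = v∈Q
      ... | no v∉Q | v∈C , vr = contradiction
        (few (C⊆S v∈C) v∉Q x∈Q r∈Q
          (K-clique v∈ (Q∩C⊆K x∈C x∈Q) (λ { refl → v∉Q x∈Q })) vr) x≢r

      -- If `Q` has a vertex besides `r`, then `x` is taken from `Q`, and `Q` consists of `r` and
      -- `K`. Otherwise `x` is arbitrary and the labels of `C` are erased after the join.
      Case : Set
      Case = x ∈ Q ⊎ (∀ {q} → q ∈ Q → q ≡ r)

      Q∖C≡r : Case → ∀ {v} → v ∈ Q → v ∉ C → v ≡ r
      Q∖C≡r (inj₂ Q≡r) v∈Q _ = Q≡r v∈Q
      Q∖C≡r (inj₁ x∈Q) {v} v∈Q v∉C with v ≟ r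
      ... | yes v≡r = v≡r
      ... | no v≢r = contradiction
        (closed′ x∈C (Q⊆S v∈Q) v≢r (clique x∈Q v∈Q (λ { refl → v∉C x∈C }))) v∉C

      colour : Case → Maybe Bool
      colour (inj₁ _) = nothing
      colour (inj₂ _) = just false

      C-label : ∀ c {v} → v ∈ C → member Q v ≡ fromMaybe (member K v) (colour c)
      C-label (inj₁ x∈Q) v∈C = member-cong (Q∩C⊆K v∈C) (K⊆Q x∈Q)
      C-label (inj₂ Q≡r) {v} v∈C = dec-false (v ∈? Q) (λ v∈Q → C≢r v∈C (Q≡r v∈Q))

      rest-label : Case → ∀ {v} → v ∈ S ∖ C → member Q v ≡ member ⁅ r ⁆ v
      rest-label c {v} v∈ = member-cong
        (λ v∈Q → subst (_∈ ⁅ r ⁆) (sym (Q∖C≡r c v∈Q (proj₂ (∖⁻ v∈)))) (x∈⁅x⁆ r))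
        (λ v∈r → subst (_∈ Q) (sym (x∈⁅y⁆⇒x≡y r v∈r)) r∈Q)

      cross-adj : ∀ {u v} → u ∈ S ∖ C → v ∈ C → adj G u v ≡ member ⁅ r ⁆ u ∧ member K v
      cross-adj {u} {v} u∈ v∈ = adj≡does (u ∈? ⁅ r ⁆ ×-dec v ∈? K) to from
        where
        to : u ~ v → u ∈ ⁅ r ⁆ × v ∈ K
        to uv with u ≟ r | ∖⁻ u∈
        ... | yes refl | _ = x∈⁅x⁆ u , K⁺ v∈ (~-sym uv)
        ... | no u≢r | u∈S , u∉C = contradiction (closed′ v∈ u∈S u≢r (~-sym uv)) u∉C
        from : u ∈ ⁅ r ⁆ × v ∈ K → u ~ v
        from (u∈r , v∈K) rewrite x∈⁅y⁆⇒x≡y r u∈r = ~-sym (proj₂ (K⁻ v∈K))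

      -- As `C` is a component after removing `r`, its only edges to the rest of `S` join `r` to
      -- `K`. Marking `r` in the rest and `K` in `C` therefore makes conjunction the right rule for
      -- the join.
      block-step : Case → (∀ {T P} → T ⊂ S → GoodClique T P → Built T (member P)) → Built S (member Q)
      block-step c ih = join
        (ih ((λ v∈ → proj₁ (∖⁻ v∈)) , x , x∈S , (λ x∈ → proj₂ (∖⁻ {S} x∈) x∈C))
          (singleton-good (∖⁺ r∈S r∉C)))
        (ih (C⊆S , r , r∈S , r∉C) K-good)
        _∧_ nothing (colour c) (λ v∈ → proj₁ (∖⁻ v∈)) C⊆S (∖-split S C) (λ v∈ → proj₂ (∖⁻ v∈))
        cross-adj (rest-label c) (C-label c)

    rooted-block : ∀ {S Q r} → DiamondFree S → GoodClique S Q → r ∈ Q →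
                   (∀ {T P} → T ⊂ S → GoodClique T P → Built T (member P)) → Built S (member Q)
    rooted-block {S} {Q} {r} diamond-free good r∈Q ih
      with any? (λ x → x ∈? Q ×-dec ¬? (x ≟ r)) | any? (λ x → x ∈? S ×-dec ¬? (x ≟ r))
    ... | yes (x , x∈Q , x≢r) | _ =
      BlockStep.block-step diamond-free good r∈Q (GoodClique.Q⊆S good x∈Q) x≢r (inj₁ x∈Q) ih
    ... | no Q≡r | yes (x , x∈S , x≢r) =
      BlockStep.block-step diamond-free good r∈Q x∈S x≢r (inj₂ only-r) ih
      where
      only-r : ∀ {q} → q ∈ Q → q ≡ r
      only-r {q} q∈ with q ≟ r
      ... | yes q≡r = q≡r
      ... | no q≢r = contradiction (q , q∈ , q≢r) Q≡r
    ... | no _ | no S≡r = single (GoodClique.Q⊆S good r∈Q) only-r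
      where
      only-r : ∀ {u} → u ∈ S → u ≡ r
      only-r {u} u∈ with u ≟ r
      ... | yes u≡r = u≡r
      ... | no u≢r = contradiction (u , u∈ , u≢r) S≡r

    block : ∀ {S} → Acc _⊂_ S → DiamondFree S → ∀ {Q} → GoodClique S Q → Built S (member Q)
    block {S} (acc rec) diamond-free {Q} good = by-cases (any? (_∈? Q)) (any? (_∈? S))
      where
      ih : ∀ {T P} → T ⊂ S → GoodClique T P → Built T (member P)
      ih T⊂S@(T⊆S , _) = block (rec T⊂S)
        (λ v∈ b∈ a∈ c∈ → diamond-free (T⊆S v∈) (T⊆S b∈) (T⊆S a∈) (T⊆S c∈))
      by-cases : Dec (∃ (_∈ Q)) → Dec (∃ (_∈ S)) → Built S (member Q)
      by-cases (yes (r , r∈Q)) _ = rooted-block diamond-free good r∈Q ih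
      by-cases (no _) (no S-empty) = empty S-empty
      -- For an empty `Q` any vertex serves as the root, and its mark is erased afterwards.
      by-cases (no Q-empty) (yes (r , r∈S)) =
        recast (rooted-block diamond-free (singleton-good r∈S) (x∈⁅x⁆ r) ih) (just false) id id
          (λ {v} _ → dec-false (v ∈? Q) (λ v∈ → Q-empty (v , v∈)))

-- Modules and spiders

module Substitute (G : Graph) where
  open TwoLabelled G
  open Adjacency G
  open Build G

  Buildable : Subset (n G) → Set
  Buildable S = ∀ c → Built S (λ _ → c)

  module _ {M : Subset (n G)} (M-built : Buildable M) (m : V) where

    graft : Subset (n G) → Subset (n G)
    graft S = M ∪ (S ∖ ⁅ m ⁆)

    ∈graft-M : ∀ {S v} → v ∈ M → v ∈ graft S
    ∈graft-M v∈ = p⊆p∪q _ v∈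

    ∈graft-S : ∀ {S v} → v ∈ S → v ≢ m → v ∈ graft S
    ∈graft-S v∈ v≢m = q⊆p∪q M _ (∖⁺ v∈ (v≢m ∘ x∈⁅y⁆⇒x≡y m))

    graft⁻ : ∀ {S v} → v ∈ graft S → v ∈ M ⊎ (v ∈ S × v ≢ m)
    graft⁻ v∈ with x∈p∪q⁻ M _ v∈
    ... | inj₁ v∈M = inj₁ v∈M
    ... | inj₂ v∈S∖m with ∖⁻ v∈S∖m
    ... | v∈S , v∉m = inj₂ (v∈S , λ { refl → v∉m (x∈⁅x⁆ m) })

    grafted : (V → Bool) → V → Bool
    grafted l v = if member M v then l m else l v

    grafted-M : ∀ l {v} → v ∈ M → grafted l v ≡ l m
    grafted-M l {v} v∈ rewrite dec-true (v ∈? M) v∈ = refl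

    grafted-S : ∀ l {v} → v ∉ M → grafted l v ≡ l v
    grafted-S l {v} v∉ rewrite dec-false (v ∈? M) v∉ = refl

    -- Follow the construction down to the leaf that creates `m` and build `M` there instead,
    -- entirely in the label of `m`. By uniformity each later join treats `M` as it treated `m`.
    replace : ∀ {S l} → Built S l → m ∈ S → (∀ {v} → v ∈ S → v ∈ M → v ≡ m) →
              (∀ {v y} → v ∈ S → v ≢ m → y ∈ M → adj G v y ≡ adj G v m) →
              Built (graft S) (grafted l)
    replace (empty ∅) m∈ _ _ = contradiction (m , m∈) ∅
    replace {l = l} (single _ only) m∈ _ _ = recast (M-built (l m)) nothing ∈graft-M graft⊆M (grafted-M l)
      where
      graft⊆M : ∀ {v} → v ∈ graft _ → v ∈ M
      graft⊆M v∈ with graft⁻ v∈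
      ... | inj₁ v∈M = v∈M
      ... | inj₂ (v∈ , v≢m) = contradiction (trans (only v∈) (sym (only m∈))) v≢m
    replace {W} {l} (join {S} {T} {l₁ = l₁} {l₂} p q R c₁ c₂ S⊆W T⊆W split disjoint adj-R l≡₁ l≡₂)
            m∈ M∩W uniform =
      [ (λ m∈S → half p q R c₁ c₂ S⊆W T⊆W split disjoint adj-R l≡₁ l≡₂ m∈S
          (replace p m∈S (M∩W ∘ S⊆W) (uniform ∘ S⊆W)))
      -- If `m` lies in the right part, the two parts are exchanged.
      , (λ m∈T → half q p (flip R) c₂ c₁ T⊆W S⊆W (swap ∘ split) (flip disjoint)
          (λ u∈ v∈ → trans (adj-sym G _ _) (adj-R v∈ u∈)) l≡₂ l≡₁ m∈T
          (replace q m∈T (M∩W ∘ T⊆W) (uniform ∘ T⊆W))) ]′ (split m∈)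
      where
      half : ∀ {S T l₁ l₂} → Built S l₁ → Built T l₂ →
             (R : Bool → Bool → Bool) (c₁ c₂ : Maybe Bool) →
             S ⊆ W → T ⊆ W → (∀ {v} → v ∈ W → v ∈ S ⊎ v ∈ T) → (∀ {v} → v ∈ S → v ∉ T) →
             (∀ {u v} → u ∈ S → v ∈ T → adj G u v ≡ R (l₁ u) (l₂ v)) →
             (∀ {v} → v ∈ S → l v ≡ fromMaybe (l₁ v) c₁) →
             (∀ {v} → v ∈ T → l v ≡ fromMaybe (l₂ v) c₂) →
             m ∈ S → Built (graft S) (grafted l₁) → Built (graft W) (grafted l)
      half {S} {T} {l₁} {l₂} p q R c₁ c₂ S⊆W T⊆W split disjoint adj-R l≡₁ l≡₂ m∈S p′ =
        join p′ q R c₁ c₂ graft⊆ T⊆graft split′ disjoint′ adj-R′ l≡₁′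
          (λ v∈ → trans (grafted-S l (T∩M v∈)) (l≡₂ v∈))
        where
        T≢m : ∀ {v} → v ∈ T → v ≢ m
        T≢m v∈ refl = disjoint m∈S v∈
        T∩M : ∀ {v} → v ∈ T → v ∉ M
        T∩M v∈ v∈M = T≢m v∈ (M∩W (T⊆W v∈) v∈M)
        S∩M : ∀ {v} → v ∈ S → v ≢ m → v ∉ M
        S∩M v∈ v≢m v∈M = v≢m (M∩W (S⊆W v∈) v∈M)
        graft⊆ : graft S ⊆ graft W
        graft⊆ v∈ with graft⁻ v∈
        ... | inj₁ v∈M = ∈graft-M v∈M
        ... | inj₂ (v∈S , v≢m) = ∈graft-S (S⊆W v∈S) v≢m
        T⊆graft : T ⊆ graft W
        T⊆graft v∈ = ∈graft-S (T⊆W v∈) (T≢m v∈)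
        split′ : ∀ {v} → v ∈ graft W → v ∈ graft S ⊎ v ∈ T
        split′ v∈ with graft⁻ v∈
        ... | inj₁ v∈M = inj₁ (∈graft-M v∈M)
        ... | inj₂ (v∈W , v≢m) with split v∈W
        ... | inj₁ v∈S = inj₁ (∈graft-S v∈S v≢m)
        ... | inj₂ v∈T = inj₂ v∈T
        disjoint′ : ∀ {v} → v ∈ graft S → v ∉ T
        disjoint′ v∈ v∈T with graft⁻ v∈
        ... | inj₁ v∈M = T∩M v∈T v∈M
        ... | inj₂ (v∈S , _) = disjoint v∈S v∈T
        adj-R′ : ∀ {u v} → u ∈ graft S → v ∈ T → adj G u v ≡ R (grafted l₁ u) (l₂ v)
        adj-R′ {u} {v} u∈ v∈T with graft⁻ u∈
        ... | inj₁ u∈M = trans (adj-sym G u v) (trans (uniform (T⊆W v∈T) (T≢m v∈T) u∈M)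
                (trans (adj-sym G v m) (trans (adj-R m∈S v∈T)
                  (cong (λ c → R c (l₂ v)) (sym (grafted-M l₁ u∈M))))))
        ... | inj₂ (u∈S , u≢m) = trans (adj-R u∈S v∈T)
                (cong (λ c → R c (l₂ v)) (sym (grafted-S l₁ (S∩M u∈S u≢m))))
        l≡₁′ : ∀ {v} → v ∈ graft S → grafted l v ≡ fromMaybe (grafted l₁ v) c₁
        l≡₁′ v∈ with graft⁻ v∈
        ... | inj₁ v∈M = trans (grafted-M l v∈M) (trans (l≡₁ m∈S)
                (cong (λ c → fromMaybe c c₁) (sym (grafted-M l₁ v∈M))))
        ... | inj₂ (v∈S , v≢m) = trans (grafted-S l (S∩M v∈S v≢m)) (trans (l≡₁ v∈S)
                (cong (λ c → fromMaybe c c₁) (sym (grafted-S l₁ (S∩M v∈S v≢m)))))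

  -- Contracting `M` to `m` leaves the quotient `Q`, into which `M` is substituted. Induction
  -- applies to both: `s` is missing from `M`, and `m′` is missing from `Q`.
  module-buildable : ∀ {S M m m′ s} → M ⊆ S → m ∈ M → m′ ∈ M → m ≢ m′ → s ∈ S → s ∉ M →
                     (∀ {x y y′} → x ∈ S → x ∉ M → y ∈ M → y′ ∈ M → adj G x y ≡ adj G x y′) →
                     (∀ {T} → T ⊂ S → Buildable T) → Buildable S
  module-buildable {S} {M} {m} {m′} {s} M⊆S m∈ m′∈ m≢m′ s∈ s∉ uniform ih c =
    recolour c (recast (replace (ih (M⊆S , s , s∈ , s∉)) m (ih Q⊂S c) m∈Q M∩Q uniform′)
      nothing to from (λ _ → refl))
    where
    Q : Subset (n G)
    Q = ⁅ m ⁆ ∪ (S ∖ M)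
    m∈Q : m ∈ Q
    m∈Q = p⊆p∪q _ (x∈⁅x⁆ m)
    Q⁻ : ∀ {v} → v ∈ Q → v ≡ m ⊎ (v ∈ S × v ∉ M)
    Q⁻ v∈ with x∈p∪q⁻ ⁅ m ⁆ _ v∈
    ... | inj₁ v∈m = inj₁ (x∈⁅y⁆⇒x≡y m v∈m)
    ... | inj₂ v∈ = inj₂ (∖⁻ v∈)
    Q⊆S : Q ⊆ S
    Q⊆S v∈ with Q⁻ v∈
    ... | inj₁ refl = M⊆S m∈
    ... | inj₂ (v∈S , _) = v∈S
    m′∉Q : m′ ∉ Q
    m′∉Q v∈ with Q⁻ v∈
    ... | inj₁ m′≡m = m≢m′ (sym m′≡m)
    ... | inj₂ (_ , m′∉) = m′∉ m′∈
    Q⊂S : Q ⊂ S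
    Q⊂S = Q⊆S , m′ , M⊆S m′∈ , m′∉Q
    M∩Q : ∀ {v} → v ∈ Q → v ∈ M → v ≡ m
    M∩Q v∈ v∈M with Q⁻ v∈
    ... | inj₁ v≡m = v≡m
    ... | inj₂ (_ , v∉M) = contradiction v∈M v∉M
    uniform′ : ∀ {v y} → v ∈ Q → v ≢ m → y ∈ M → adj G v y ≡ adj G v m
    uniform′ v∈ v≢m y∈ with Q⁻ v∈
    ... | inj₁ v≡m = contradiction v≡m v≢m
    ... | inj₂ (v∈S , v∉M) = uniform v∈S v∉M y∈ m∈
    to : ∀ {v} → v ∈ graft (ih (M⊆S , s , s∈ , s∉)) m Q → v ∈ S
    to v∈ with graft⁻ (ih (M⊆S , s , s∈ , s∉)) m v∈
    ... | inj₁ v∈M = M⊆S v∈M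
    ... | inj₂ (v∈Q , _) = Q⊆S v∈Q
    from : ∀ {v} → v ∈ S → v ∈ graft (ih (M⊆S , s , s∈ , s∉)) m Q
    from {v} v∈ with v ∈? M
    ... | yes v∈M = ∈graft-M (ih (M⊆S , s , s∈ , s∉)) m v∈M
    ... | no v∉M = ∈graft-S (ih (M⊆S , s , s∈ , s∉)) m (q⊆p∪q ⁅ m ⁆ _ (∖⁺ v∈ v∉M)) λ { refl → v∉M m∈ }

  -- The vertices outside `K` that miss `k` form the leg of `k`, and those that miss nothing form
  -- the head. By `few` the legs are disjoint, and by `apart` there are no edges between different
  -- legs or between a leg and the head.
  record Spider (X K : Subset (n G)) : Set where
    field
      K⊆X    : K ⊆ X
      clique : ∀ {u v} → u ∈ K → v ∈ K → u ≢ v → u ~ v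
      few    : ∀ {x k k′} → x ∈ X → x ∉ K → k ∈ K → k′ ∈ K → k ≢ k′ → x ≁ k → x ~ k′
      apart  : ∀ {x y k} → x ∈ X → x ∉ K → y ∈ X → y ∉ K → k ∈ K → x ≁ k → y ~ k → x ≁ y

  -- Split off `k` together with its leg. Every remaining vertex sees `k`, and the leg is seen by
  -- exactly the remaining vertices of `K`; hence a disjunction of marks describes the join. When
  -- `K` is used up, only the head is left.
  spider : ∀ {X K} → Acc _⊂_ X → Spider X K →
           (∀ {Y} → Y ⊆ X → (∀ {v} → v ∈ Y → v ∉ K) → Buildable Y) → Built X (member K)
  spider {X} {K} (acc rec) sp parts with any? (_∈? K)
  ... | no K-empty = recast (parts id (λ {v} _ v∈ → K-empty (v , v∈)) false) nothing id id
                       (λ {v} _ → dec-false (v ∈? K) (λ v∈ → K-empty (v , v∈)))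
  ... | yes (k , k∈K) =
    join body leg _∨_ nothing nothing (proj₁ ∘ ∖⁻) P⊆X (∖-split X P) (proj₂ ∘ ∖⁻) cross-adj
      body-label leg-label
    where
    open Spider sp
    S? : ∀ v → Dec (v ∈ X × v ∉ K × v ≁ k)
    S? v = v ∈? X ×-dec ¬? (v ∈? K) ×-dec ¬? (v ~? k)
    S P X′ K′ : Subset (n G)
    S = sep S?
    P = ⁅ k ⁆ ∪ S
    X′ = X ∖ P
    K′ = K ∖ ⁅ k ⁆
    k∈P : k ∈ P
    k∈P = p⊆p∪q S (x∈⁅x⁆ k)
    P⁻ : ∀ {v} → v ∈ P → v ≡ k ⊎ (v ∈ X × v ∉ K × v ≁ k)
    P⁻ v∈ with x∈p∪q⁻ ⁅ k ⁆ S v∈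
    ... | inj₁ v∈k = inj₁ (x∈⁅y⁆⇒x≡y k v∈k)
    ... | inj₂ v∈S = inj₂ (∈sep⁻ S? v∈S)
    P⊆X : P ⊆ X
    P⊆X v∈ with P⁻ v∈
    ... | inj₁ refl = K⊆X k∈K
    ... | inj₂ (v∈X , _) = v∈X
    K′⁺ : ∀ {v} → v ∈ K → v ≢ k → v ∈ K′
    K′⁺ v∈ v≢k = ∖⁺ v∈ (v≢k ∘ x∈⁅y⁆⇒x≡y k)
    K′⁻ : ∀ {v} → v ∈ K′ → v ∈ K × v ≢ k
    K′⁻ v∈ with ∖⁻ v∈
    ... | v∈K , v∉k = v∈K , λ { refl → v∉k (x∈⁅x⁆ k) }
    X′⊆X : X′ ⊆ X
    X′⊆X = proj₁ ∘ ∖⁻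
    X′≢k : ∀ {v} → v ∈ X′ → v ≢ k
    X′≢k v∈ refl = proj₂ (∖⁻ v∈) k∈P
    ∉K : ∀ {v} → v ∈ X′ → v ∉ K′ → v ∉ K
    ∉K v∈ v∉K′ v∈K = v∉K′ (K′⁺ v∈K (X′≢k v∈))
    X′~k : ∀ {v} → v ∈ X′ → v ~ k
    X′~k {v} v∈ with v ~? k | v ∈? K
    ... | yes v~k | _ = v~k
    ... | no _ | yes v∈K = clique v∈K k∈K (X′≢k v∈)
    ... | no v≁k | no v∉K = contradiction
      (q⊆p∪q ⁅ k ⁆ S (∈sep⁺ S? (X′⊆X v∈ , v∉K , v≁k))) (proj₂ (∖⁻ v∈))
    spider′ : Spider X′ K′
    spider′ = record
      { K⊆X = λ v∈ → ∖⁺ (K⊆X (proj₁ (K′⁻ v∈))) (∉P v∈)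
      ; clique = λ u∈ v∈ → clique (proj₁ (K′⁻ u∈)) (proj₁ (K′⁻ v∈))
      ; few = λ x∈ x∉ k∈ k′∈ → few (X′⊆X x∈) (∉K x∈ x∉) (proj₁ (K′⁻ k∈)) (proj₁ (K′⁻ k′∈))
      ; apart = λ x∈ x∉ y∈ y∉ k∈ →
          apart (X′⊆X x∈) (∉K x∈ x∉) (X′⊆X y∈) (∉K y∈ y∉) (proj₁ (K′⁻ k∈)) }
      where
      ∉P : ∀ {v} → v ∈ K′ → v ∉ P
      ∉P v∈ v∈P with P⁻ v∈P | K′⁻ v∈
      ... | inj₁ v≡k | _ , v≢k = v≢k v≡k
      ... | inj₂ (_ , v∉K , _) | v∈K , _ = v∉K v∈K
    body : Built X′ (member K′)
    body = spider (rec (X′⊆X , k , K⊆X k∈K , λ k∈ → X′≢k k∈ refl)) spider′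
      (λ Y⊆ Y∩K′ → parts (X′⊆X ∘ Y⊆) (λ v∈ → ∉K (Y⊆ v∈) (Y∩K′ v∈)))
    k∉S : k ∉ S
    k∉S k∈ = proj₁ (proj₂ (∈sep⁻ S? k∈)) k∈K
    leg : Built P (member ⁅ k ⁆)
    leg = join (single {⁅ k ⁆} {λ _ → true} (x∈⁅x⁆ k) (x∈⁅y⁆⇒x≡y k))
      (parts (proj₁ ∘ ∈sep⁻ S?) (proj₁ ∘ proj₂ ∘ ∈sep⁻ S?) false) (λ _ _ → false) nothing nothing
      (p⊆p∪q S) (q⊆p∪q ⁅ k ⁆ S) (x∈p∪q⁻ ⁅ k ⁆ S)
      (λ u∈ u∈S → k∉S (subst (_∈ S) (x∈⁅y⁆⇒x≡y k u∈) u∈S))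
      (λ {u} {v} u∈ v∈ → trans (cong (λ w → adj G w v) (x∈⁅y⁆⇒x≡y k u∈))
        (≁⇒false (≁-sym (proj₂ (proj₂ (∈sep⁻ S? v∈))))))
      (λ {v} → dec-true (v ∈? ⁅ k ⁆))
      (λ {v} v∈S → dec-false (v ∈? ⁅ k ⁆) (λ v∈ → k∉S (subst (_∈ S) (x∈⁅y⁆⇒x≡y k v∈) v∈S)))
    cross-adj : ∀ {u v} → u ∈ X′ → v ∈ P → adj G u v ≡ member K′ u ∨ member ⁅ k ⁆ v
    cross-adj {u} {v} u∈ v∈ = adj≡does (u ∈? K′ ⊎-dec v ∈? ⁅ k ⁆) to from
      where
      to : u ~ v → u ∈ K′ ⊎ v ∈ ⁅ k ⁆
      to uv with P⁻ v∈ | u ∈? K′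
      ... | inj₁ refl | _ = inj₂ (x∈⁅x⁆ k)
      ... | inj₂ _ | yes u∈K′ = inj₁ u∈K′
      ... | inj₂ (v∈X , v∉K , v≁k) | no u∉K′ = contradiction (~-sym uv)
        (apart v∈X v∉K (X′⊆X u∈) (∉K u∈ u∉K′) k∈K v≁k (X′~k u∈))
      from : u ∈ K′ ⊎ v ∈ ⁅ k ⁆ → u ~ v
      from (inj₂ v∈k) rewrite x∈⁅y⁆⇒x≡y k v∈k = X′~k u∈
      from (inj₁ u∈K′) with P⁻ v∈ | K′⁻ u∈K′
      ... | inj₁ refl | _ = X′~k u∈
      ... | inj₂ (v∈X , v∉K , v≁k) | u∈K , u≢k =
        ~-sym (few v∈X v∉K k∈K u∈K (u≢k ∘ sym) v≁k)
    body-label : ∀ {v} → v ∈ X′ → member K v ≡ member K′ v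
    body-label v∈ = member-cong (λ v∈K → K′⁺ v∈K (X′≢k v∈)) (proj₁ ∘ K′⁻)
    leg-label : ∀ {v} → v ∈ P → member K v ≡ member ⁅ k ⁆ v
    leg-label {v} v∈ = member-cong to (λ v∈k → subst (_∈ K) (sym (x∈⁅y⁆⇒x≡y k v∈k)) k∈K)
      where
      to : v ∈ K → v ∈ ⁅ k ⁆
      to v∈K with P⁻ v∈
      ... | inj₁ refl = x∈⁅x⁆ k
      ... | inj₂ (_ , v∉K , _) = contradiction v∈K v∉K

-- Decomposing at a diamond

module Decompose (G : Graph) (chordal : Chordal G) (kite-free : co-S112 Free G) where
  open TwoLabelled G
  open Adjacency G
  open Paths G
  open Build G
  open Substitute G

  neighbour? : ∀ S e v → Dec (v ∈ S × v ~ e)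
  neighbour? S e v = v ∈? S ×-dec v ~? e

  neighbours : Subset (n G) → V → Subset (n G)
  neighbours S e = sep (neighbour? S e)

  adj-cong : ∀ {x y y′} → (x ~ y → x ~ y′) → (x ~ y′ → x ~ y) → adj G x y ≡ adj G x y′
  adj-cong {x} {y} {y′} f g with x ~? y′
  ... | yes xy′ = trans (g xy′) (sym xy′)
  ... | no x≁y′ = trans (≁⇒false (x≁y′ ∘ f)) (sym (≁⇒false x≁y′))

  module Neighbourhood {S : Subset (n G)} {e : V} (e∈S : e ∈ S)
                       {x₀ : V} (comp : Component (neighbours S e) x₀) where
    open Component comp renaming (C to D; C⊆T to D⊆N) public

    D⊆S : D ⊆ S
    D⊆S = proj₁ ∘ ∈sep⁻ (neighbour? S e) ∘ D⊆N

    D~e : ∀ {v} → v ∈ D → v ~ e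
    D~e = proj₂ ∘ ∈sep⁻ (neighbour? S e) ∘ D⊆N

    D-closed : ∀ {u v} → u ∈ D → v ∈ S → v ~ e → u ~ v → v ∈ D
    D-closed u∈ v∈ ve = closed u∈ (∈sep⁺ (neighbour? S e) (v∈ , ve))

    e∉D : e ∉ D
    e∉D e∈ = ~⇒≢ (D~e e∈) refl

    Nonuniversal : V → Set
    Nonuniversal u = ∃ λ f → f ∈ D × f ≢ u × f ≁ u

    nonuniversal? : ∀ u → Dec (Nonuniversal u)
    nonuniversal? u = any? (λ f → f ∈? D ×-dec ¬? (f ≟ u) ×-dec ¬? (f ~? u))

    Outer : V → Set
    Outer y = y ∈ S × y ≢ e × y ≁ e

    outer? : ∀ y → Dec (Outer y)
    outer? y = y ∈? S ×-dec ¬? (y ≟ e) ×-dec ¬? (y ~? e)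

    outer≢D : ∀ {y v} → Outer y → v ∈ D → y ≢ v
    outer≢D (_ , _ , y≁e) v∈ refl = y≁e (D~e v∈)

    -- Otherwise `y`, `u`, `e`, `v` would be an induced 4-cycle.
    outer-clique : ∀ {y u v} → Outer y → u ∈ D → v ∈ D → y ~ u → y ~ v → u ≢ v → u ~ v
    outer-clique (_ , y≢e , y≁e) u∈ v∈ yu yv =
      four-cycle-chord chordal yu (~-sym (D~e u∈)) yv (~-sym (D~e v∈)) y≢e y≁e

    -- The edge between `e` and `g` is the middle of a diamond with tips `u` and `w`; since `y` sees
    -- the tip `u` but not `e`, it must see `g`.
    outer-middle : ∀ {y u w g} → Outer y → u ∈ D → w ∈ D → g ∈ D → y ~ u → u ≢ w → u ≁ w →
                   g ~ u → g ~ w → y ~ g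
    outer-middle y-out@(_ , y≢e , y≁e) u∈ w∈ g∈ yu u≢w u≁w gu gw =
      diamond-neighbour chordal kite-free (~-sym (D~e g∈)) (D~e u∈) (~-sym gu) (D~e w∈) (~-sym gw)
        u≢w u≁w yu y≢e (outer≢D y-out g∈) y≁e

    module _ {y u v : V} (y-out : Outer y) (u∈ : u ∈ D) (v∈ : v ∈ D)
             (yu : y ~ u) (yv : y ~ v) (u≢v : u ≢ v) where
      private
        uv : u ~ v
        uv = outer-clique y-out u∈ v∈ yu yv u≢v

      -- Now `u` and `v` are the middle of a diamond with tips `e` and `y`, so a neighbour of a tip
      -- cannot miss both of them. The tip is `e` here and `y` in `outer-covered`.
      e-covered : ∀ {x} → x ~ e → x ≢ u → x ≢ v → x ≁ u → x ~ v
      e-covered xe = diamond-neighbour chordal kite-free uv (~-sym (D~e u∈)) (~-sym (D~e v∈)) yu yv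
        (proj₁ (proj₂ y-out) ∘ sym) (≁-sym (proj₂ (proj₂ y-out))) xe

      outer-covered : ∀ {x} → x ~ y → x ≢ u → x ≢ v → x ≁ u → x ~ v
      outer-covered xy = diamond-neighbour chordal kite-free uv yu yv (~-sym (D~e u∈)) (~-sym (D~e v∈))
        (proj₁ (proj₂ y-out)) (proj₂ (proj₂ y-out)) xy

    -- The spider when no vertex of the component is universal

    module Legs (all-nonuniversal : ∀ {u} → u ∈ D → Nonuniversal u) where

      -- A walk from `u` to a vertex that `u` misses leaves the closed neighbourhood of `u` at some
      -- step from `g` to `f`.
      far : ∀ {u} → u ∈ D → ∃₂ λ g f → g ∈ D × f ∈ D × g ~ u × g ~ f × f ≢ u × f ≁ u
      far {u} u∈ with all-nonuniversal u∈
      ... | f , f∈ , f≢u , f≁u = walk (connected u∈ f∈) (inj₁ refl)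
        where
        walk : ∀ {v} → Star (Within D) v f → v ≡ u ⊎ v ~ u → _
        walk ε (inj₁ f≡u) = contradiction f≡u f≢u
        walk ε (inj₂ fu) = contradiction fu f≁u
        walk ((_ , _ , uw) ◅ rest) (inj₁ refl) = walk rest (inj₂ (~-sym uw))
        walk (_◅_ {j = w} (v∈ , w∈ , vw) rest) (inj₂ vu) with w ≟ u | w ~? u
        ... | yes w≡u | _ = walk rest (inj₁ w≡u)
        ... | no _ | yes wu = walk rest (inj₂ wu)
        ... | no w≢u | no w≁u = _ , w , v∈ , w∈ , vu , vw , w≢u , w≁u

      -- Supplies the second vertex of `D` seen by `y` that `e-covered` and `outer-covered` require.
      second : ∀ {y u} → Outer y → u ∈ D → y ~ u → ∃ λ g → g ∈ D × g ~ u × y ~ g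
      second y-out u∈ yu with far u∈
      ... | g , f , g∈ , f∈ , gu , gf , f≢u , f≁u =
        g , g∈ , gu , outer-middle y-out u∈ f∈ g∈ yu (f≢u ∘ sym) (≁-sym f≁u) gu gf

      -- If `f` saw `p`, then `p` would be a common neighbour of the nonadjacent `a` and `f`, and
      -- `outer-middle` would give `z ~ p`.
      separated : ∀ {z a p f} → Outer z → a ∈ D → z ~ a → p ∈ D → z ≁ p → p ~ a →
                  f ∈ D → f ≢ a → f ≁ a → f ≢ p × f ≁ p
      separated z-out a∈ za p∈ z≁p pa f∈ f≢a f≁a =
        (λ { refl → f≁a pa }) ,
        λ fp → z≁p (outer-middle z-out a∈ f∈ p∈ za (f≢a ∘ sym) (≁-sym f≁a) pa (~-sym fp))

      -- Suppose `z` misses `p`, and let `g` be a second vertex seen by `y`, adjacent to `p`. The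
      -- aim is a vertex `f` of `D` missing both `p` and `g`, against `e-covered` for `y`. If
      -- `z ~ g`, any `f` missing `g` also misses `p` by `separated`.
      same-trace : ∀ {y z a₀ p} → Outer y → Outer z → a₀ ∈ D → z ~ a₀ → p ∈ D → y ~ p → z ~ p
      same-trace {y} {z} {a₀} {p} y-out z-out a₀∈ za₀ p∈ yp with z ~? p | second y-out p∈ yp
      ... | yes zp | _ = zp
      ... | no z≁p | g , g∈ , gp , yg with z ~? g
      ...   | yes zg with all-nonuniversal g∈
      ...     | f , f∈ , f≢g , f≁g
        with separated z-out g∈ zg p∈ z≁p (~-sym gp) f∈ f≢g f≁g
      ...       | f≢p , f≁p = contradiction
        (e-covered y-out p∈ g∈ yp yg (~⇒≢ (~-sym gp)) (D~e f∈) f≢p f≢g f≁p) f≁g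
      same-trace {y} {z} {a₀} {p} y-out z-out a₀∈ za₀ p∈ yp
          | no z≁p | g , g∈ , gp , yg | no z≁g = contradiction witness λ (a , a∈ , za , pa) → refute a∈ za pa
        -- If `z` misses `g` too, take a neighbour `a` of `p` seen by `z`. Were `g` to miss `a`,
        -- then `outer-middle` would give `z ~ p`; otherwise any `f` missing `a` misses both `p` and
        -- `g` by `separated`.
        where
        witness : ∃ λ a → a ∈ D × z ~ a × p ~ a
        witness with p ~? a₀ | second z-out a₀∈ za₀
        ... | yes pa₀ | _ = a₀ , a₀∈ , za₀ , pa₀
        ... | no p≁a₀ | a₁ , a₁∈ , a₁a₀ , za₁ = a₁ , a₁∈ , za₁ ,
          e-covered z-out a₀∈ a₁∈ za₀ za₁ (~⇒≢ (~-sym a₁a₀)) (D~e p∈)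
            (λ { refl → z≁p za₀ }) (λ { refl → z≁p za₁ }) p≁a₀
        refute : ∀ {a} → a ∈ D → z ~ a → ¬ p ~ a
        refute {a} a∈ za pa with g ~? a | all-nonuniversal a∈
        ... | no g≁a | _ =
          z≁p (outer-middle z-out a∈ g∈ p∈ za (λ { refl → z≁g za }) (≁-sym g≁a) pa (~-sym gp))
        ... | yes ga | f , f∈ , f≢a , f≁a
          with separated z-out a∈ za p∈ z≁p pa f∈ f≢a f≁a | separated z-out a∈ za g∈ z≁g ga f∈ f≢a f≁a
        ...   | f≢p , f≁p | f≢g , f≁g =
          f≁g (e-covered y-out p∈ g∈ yp yg (~⇒≢ (~-sym gp)) (D~e f∈) f≢p f≢g f≁p)

      module _ {z a₀ : V} (z-out : Outer z) (a₀∈ : a₀ ∈ D) (za₀ : z ~ a₀) where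

        spine? : ∀ v → Dec (v ∈ S × (v ≡ e ⊎ (v ∈ D × z ~ v)))
        spine? v = v ∈? S ×-dec (v ≟ e ⊎-dec (v ∈? D ×-dec z ~? v))

        -- By `same-trace`, an outer vertex that sees anything in `D` sees `a₀`, so this one test
        -- catches all of them.
        extent? : ∀ v → Dec (v ∈ S × (v ≡ e ⊎ v ∈ D ⊎ v ~ a₀))
        extent? v = v ∈? S ×-dec (v ≟ e ⊎-dec (v ∈? D ⊎-dec v ~? a₀))

        K X : Subset (n G)
        K = sep spine?
        X = sep extent?

        trace : ∀ {y p} → Outer y → y ~ a₀ → p ∈ D → z ~ p → y ~ p
        trace y-out ya₀ p∈ zp = same-trace z-out y-out a₀∈ ya₀ p∈ zp

        trace⁻ : ∀ {y p} → Outer y → p ∈ D → y ~ p → z ~ p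
        trace⁻ y-out = same-trace y-out z-out a₀∈ za₀

        K-D : ∀ {v} → v ∈ D → z ~ v → v ∈ K
        K-D v∈ zv = ∈sep⁺ spine? (D⊆S v∈ , inj₂ (v∈ , zv))

        e∈K : e ∈ K
        e∈K = ∈sep⁺ spine? (e∈S , inj₁ refl)

        K⊆X : K ⊆ X
        K⊆X v∈ with ∈sep⁻ spine? v∈
        ... | v∈S , inj₁ v≡e = ∈sep⁺ extent? (v∈S , inj₁ v≡e)
        ... | v∈S , inj₂ (v∈D , _) = ∈sep⁺ extent? (v∈S , inj₂ (inj₁ v∈D))

        D⊆X : D ⊆ X
        D⊆X v∈ = ∈sep⁺ extent? (D⊆S v∈ , inj₂ (inj₁ v∈))

        -- The outer vertices form the leg of `e`; the inner ones see `e` and make up the other legs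
        -- and the head.
        data Leg (v : V) : Set where
          inner : v ∈ D → z ≁ v → Leg v
          outer : Outer v → v ~ a₀ → Leg v

        leg : ∀ {v} → v ∈ X → v ∉ K → Leg v
        leg {v} v∈ v∉ with v ≟ e | v ∈? D | z ~? v | v ~? e | ∈sep⁻ extent? v∈
        ... | yes refl | _ | _ | _ | _ = contradiction e∈K v∉
        ... | no _ | yes v∈D | yes zv | _ | _ = contradiction (K-D v∈D zv) v∉
        ... | no _ | yes v∈D | no z≁v | _ | _ = inner v∈D z≁v
        ... | no v≢e | no _ | _ | _ | _ , inj₁ v≡e = contradiction v≡e v≢e
        ... | no _ | no v∉D | _ | _ | _ , inj₂ (inj₁ v∈D) = contradiction v∈D v∉D
        ... | no _ | no v∉D | _ | yes ve | v∈S , inj₂ (inj₂ va₀) =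
          contradiction (D-closed a₀∈ v∈S ve (~-sym va₀)) v∉D
        ... | no v≢e | no _ | _ | no v≁e | v∈S , inj₂ (inj₂ va₀) = outer (v∈S , v≢e , v≁e) va₀

        data Spine (v : V) : Set where
          centre : v ≡ e → Spine v
          ring   : v ∈ D → z ~ v → Spine v

        spine : ∀ {v} → v ∈ K → Spine v
        spine v∈ with ∈sep⁻ spine? v∈
        ... | _ , inj₁ v≡e = centre v≡e
        ... | _ , inj₂ (v∈D , zv) = ring v∈D zv

        X-spider : Spider X K
        X-spider = record { K⊆X = K⊆X ; clique = clique ; few = few ; apart = apart }
          where
          clique : ∀ {u v} → u ∈ K → v ∈ K → u ≢ v → u ~ v
          clique u∈ v∈ u≢v with spine u∈ | spine v∈
          ... | centre refl | centre refl = contradiction refl u≢v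
          ... | centre refl | ring v∈D _ = ~-sym (D~e v∈D)
          ... | ring u∈D _ | centre refl = D~e u∈D
          ... | ring u∈D zu | ring v∈D zv = outer-clique z-out u∈D v∈D zu zv u≢v

          few : ∀ {x k k′} → x ∈ X → x ∉ K → k ∈ K → k′ ∈ K → k ≢ k′ → x ≁ k → x ~ k′
          few x∈ x∉ k∈ k′∈ k≢k′ x≁k with leg x∈ x∉ | spine k∈ | spine k′∈
          ... | inner x∈D _ | centre refl | _ = contradiction (D~e x∈D) x≁k
          ... | inner x∈D _ | ring _ _ | centre refl = D~e x∈D
          ... | inner x∈D z≁x | ring k∈D zk | ring k′∈D zk′ =
            e-covered z-out k∈D k′∈D zk zk′ k≢k′ (D~e x∈D)
              (λ { refl → z≁x zk }) (λ { refl → z≁x zk′ }) x≁k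
          ... | outer _ _ | centre refl | centre refl = contradiction refl k≢k′
          ... | outer x-out xa₀ | ring k∈D zk | _ = contradiction (trace x-out xa₀ k∈D zk) x≁k
          ... | outer x-out xa₀ | centre _ | ring k′∈D zk′ = trace x-out xa₀ k′∈D zk′

          apart : ∀ {x y k} → x ∈ X → x ∉ K → y ∈ X → y ∉ K → k ∈ K → x ≁ k → y ~ k → x ≁ y
          apart x∈ x∉ y∈ y∉ k∈ x≁k yk xy with leg x∈ x∉ | leg y∈ y∉ | spine k∈
          ... | inner x∈D _ | _ | centre refl = x≁k (D~e x∈D)
          ... | outer _ _ | outer (_ , _ , y≁e) _ | centre refl = y≁e yk
          ... | outer x-out _ | inner y∈D z≁y | _ = z≁y (trace⁻ x-out y∈D xy)
          ... | outer x-out xa₀ | _ | ring k∈D zk = x≁k (trace x-out xa₀ k∈D zk)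
          ... | inner x∈D z≁x | outer y-out _ | _ = z≁x (trace⁻ y-out x∈D (~-sym xy))
          ... | inner x∈D z≁x | inner y∈D z≁y | ring k∈D zk =
            proj₂ (separated z-out k∈D zk y∈D z≁y yk x∈D (λ { refl → z≁x zk }) x≁k) xy

        -- Such an `x` sees nothing in `D`: otherwise it would belong to `D` or see `a₀`. If it saw
        -- `e` or an outer vertex of `X`, it would have to see `a₀` or `a₁`, both in `D`, by the
        -- covering lemmas.
        isolated : ∀ {x u} → x ∈ S → x ∉ X → u ∈ X → x ≁ u
        isolated {x} {u} x∈S x∉ u∈ xu with second z-out a₀∈ za₀
        ... | a₁ , a₁∈ , a₁a₀ , za₁ = by-cases (u ∈? K)
          where
          a₀≢a₁ : a₀ ≢ a₁
          a₀≢a₁ = ~⇒≢ (~-sym a₁a₀)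
          x≢e : x ≢ e
          x≢e refl = x∉ (K⊆X e∈K)
          x≢D : ∀ {v} → v ∈ D → x ≢ v
          x≢D v∈ refl = x∉ (D⊆X v∈)
          x≁D : ∀ {v} → v ∈ D → x ≁ v
          x≁D v∈ xv with x ~? e
          ... | yes xe = x∉ (D⊆X (D-closed v∈ x∈S xe (~-sym xv)))
          ... | no x≁e = x∉ (∈sep⁺ extent? (x∈S , inj₂ (inj₂
            (same-trace z-out (x∈S , x≢e , x≁e) v∈ xv a₀∈ za₀))))
          by-cases : ¬ Dec (u ∈ K)
          by-cases (yes u∈K) with spine u∈K
          ... | centre refl = x≁D a₁∈
            (e-covered z-out a₀∈ a₁∈ za₀ za₁ a₀≢a₁ xu (x≢D a₀∈) (x≢D a₁∈) (x≁D a₀∈))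
          ... | ring u∈D _ = x≁D u∈D xu
          by-cases (no u∉K) with leg u∈ u∉K
          ... | inner u∈D _ = x≁D u∈D xu
          ... | outer u-out ua₀ = x≁D a₁∈
            (outer-covered u-out a₀∈ a₁∈ ua₀ (trace u-out ua₀ a₁∈ za₁) a₀≢a₁ xu
              (x≢D a₀∈) (x≢D a₁∈) (x≁D a₀∈))

        spider-buildable : (∀ {T} → T ⊂ S → Buildable T) → Buildable S
        spider-buildable ih c =
          recolour c (join (spider (⊂-wellFounded X) X-spider parts)
            (ih {S ∖ X} (proj₁ ∘ ∖⁻ , e , e∈S , λ e∈ → proj₂ (∖⁻ e∈) (K⊆X e∈K)) false)
            (λ _ _ → false) nothing nothing X⊆S (proj₁ ∘ ∖⁻) (swap ∘ ∖-split S X)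
            (λ v∈ v∈′ → proj₂ (∖⁻ v∈′) v∈)
            (λ u∈ v∈ → ≁⇒false (≁-sym (isolated (proj₁ (∖⁻ v∈)) (proj₂ (∖⁻ v∈)) u∈)))
            (λ _ → refl) (λ {v} v∈ → dec-false (v ∈? K) (proj₂ (∖⁻ v∈) ∘ K⊆X)))
          where
          X⊆S : X ⊆ S
          X⊆S = proj₁ ∘ ∈sep⁻ extent?
          parts : ∀ {Y} → Y ⊆ X → (∀ {v} → v ∈ Y → v ∉ K) → Buildable Y
          -- Legs and head avoid `e`, so induction on proper subsets of `S` builds them.
          parts Y⊆X Y∩K = ih (X⊆S ∘ Y⊆X , e , e∈S , λ e∈ → Y∩K e∈ e∈K)

  -- The vertex e changes in the recursive call, but D ∪ ⁅ e ⁆ grows.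
  grow-or-build : ∀ {S} → (∀ {T} → T ⊂ S → Buildable T) →
                  ∀ {e x₀} (e∈S : e ∈ S) (comp : Component (neighbours S e) x₀) →
                  Acc _⊃_ (Component.C comp ∪ ⁅ e ⁆) →
                  (∃₂ λ a c → a ∈ Component.C comp × c ∈ Component.C comp × a ≢ c × a ≁ c) →
                  Buildable S
  grow-or-build {S} ih {e} e∈S comp (acc rec) (a , c , a∈ , c∈ , a≢c , a≁c) = result
    where
    open Neighbourhood e∈S comp

    W? : ∀ v → Dec (v ∈ D × Nonuniversal v)
    W? v = v ∈? D ×-dec nonuniversal? v

    W : Subset (n G)
    W = sep W?

    a∈W : a ∈ W
    a∈W = ∈sep⁺ W? (a∈ , c , c∈ , a≢c ∘ sym , ≁-sym a≁c)

    c∈W : c ∈ W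
    c∈W = ∈sep⁺ W? (c∈ , a , a∈ , a≢c , a≁c)

    W⊆D : W ⊆ D
    W⊆D = proj₁ ∘ ∈sep⁻ W?

    universal-adj : ∀ {u v} → v ∈ D → ¬ Nonuniversal u → v ≢ u → v ~ u
    universal-adj {u} {v} v∈ ¬nu v≢u with v ~? u
    ... | yes vu = vu
    ... | no v≁u = contradiction (v , v∈ , v≢u , v≁u) ¬nu

    -- Outside `W`, the vertex `e` sees all of `W`, other non-neighbours of `e` see nothing of it,
    -- and a neighbour of `e` that sees some of `W` lies in `D` and is universal there.
    closed-module : ¬ (∃₂ λ y w → Outer y × w ∈ W × y ~ w) → Buildable S
    closed-module none = module-buildable (D⊆S ∘ W⊆D) a∈W c∈W a≢c e∈S (e∉D ∘ W⊆D) uniform ih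
      where
      spread : ∀ {x y y′} → x ∈ S → x ∉ W → y ∈ W → y′ ∈ W → x ~ y → x ~ y′
      spread {x} {y} {y′} x∈ x∉ y∈ y′∈ xy with x ≟ e | x ~? e
      ... | yes refl | _ = ~-sym (D~e (W⊆D y′∈))
      ... | no x≢e | no x≁e = contradiction (x , y , (x∈ , x≢e , x≁e) , y∈ , xy) none
      ... | no _ | yes xe = ~-sym (universal-adj (W⊆D y′∈)
              (λ nu → x∉ (∈sep⁺ W? (D-closed (W⊆D y∈) x∈ xe (~-sym xy) , nu)))
              λ { refl → x∉ y′∈ })
      uniform : ∀ {x y y′} → x ∈ S → x ∉ W → y ∈ W → y′ ∈ W → adj G x y ≡ adj G x y′
      uniform x∈ x∉ y∈ y′∈ = adj-cong (spread x∈ x∉ y∈ y′∈) (spread x∈ x∉ y′∈ y∈)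

    module Enlarge {u y w : V} (u∈ : u ∈ D) (¬nu : ¬ Nonuniversal u)
                   (y-out : Outer y) (w∈W : w ∈ W) (yw : y ~ w) where
      w∈D : w ∈ D
      w∈D = W⊆D w∈W

      nonuniversal≢u : ∀ {v} → Nonuniversal v → v ≢ u
      nonuniversal≢u nu refl = ¬nu nu

      w≢u : w ≢ u
      w≢u = nonuniversal≢u (proj₂ (∈sep⁻ W? w∈W))

      -- The universal `u` is a common neighbour of `w` and a vertex that `w` misses, so
      -- `outer-middle` applies.
      yu : y ~ u
      yu with ∈sep⁻ W? w∈W
      ... | _ , f , f∈ , f≢w , f≁w = outer-middle y-out w∈D f∈ u∈ yw (f≢w ∘ sym) (≁-sym f≁w)
        (~-sym (universal-adj w∈D ¬nu w≢u))
        (~-sym (universal-adj f∈ ¬nu (nonuniversal≢u (w , w∈D , f≢w ∘ sym , ≁-sym f≁w))))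

      N⁺ : ∀ {v} → v ∈ S → v ~ u → v ∈ neighbours S u
      N⁺ v∈ vu = ∈sep⁺ (neighbour? S u) (v∈ , vu)

      comp′ : Component (neighbours S u) e
      comp′ = component (neighbours S u) (N⁺ e∈S (~-sym (D~e u∈)))

      open Component comp′ using () renaming (C to D′; x∈C to e∈D′; closed to closed′)

      D⊆D′ : ∀ {v} → v ∈ D → v ≢ u → v ∈ D′
      D⊆D′ v∈ v≢u = closed′ e∈D′ (N⁺ (D⊆S v∈) (universal-adj v∈ ¬nu v≢u)) (~-sym (D~e v∈))

      y∈D′ : y ∈ D′
      y∈D′ = closed′ (D⊆D′ w∈D w≢u) (N⁺ (proj₁ y-out) yu) (~-sym yw)

      -- The roles of `e` and `u` are exchanged: `u` leaves the component and `e` enters it. Adding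
      -- the centres to both sides compensates for this, and `y` is new.
      larger : (D ∪ ⁅ e ⁆) ⊂ (D′ ∪ ⁅ u ⁆)
      larger = sub , y , p⊆p∪q _ y∈D′ , y∉
        where
        sub : (D ∪ ⁅ e ⁆) ⊆ (D′ ∪ ⁅ u ⁆)
        sub {v} v∈ with x∈p∪q⁻ D _ v∈ | v ≟ u
        ... | _ | yes refl = q⊆p∪q D′ _ (x∈⁅x⁆ u)
        ... | inj₁ v∈D | no v≢u = p⊆p∪q _ (D⊆D′ v∈D v≢u)
        ... | inj₂ v∈e | no _ rewrite x∈⁅y⁆⇒x≡y e v∈e = p⊆p∪q _ e∈D′
        y∉ : y ∉ (D ∪ ⁅ e ⁆)
        y∉ y∈ with x∈p∪q⁻ D _ y∈
        ... | inj₁ y∈D = outer≢D y-out y∈D refl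
        ... | inj₂ y∈e = proj₁ (proj₂ y-out) (x∈⁅y⁆⇒x≡y e y∈e)

      enlarged : Buildable S
      enlarged = grow-or-build ih (D⊆S u∈) comp′ (rec larger)
        (a , c , D⊆D′ a∈ (nonuniversal≢u (proj₂ (∈sep⁻ W? a∈W)))
               , D⊆D′ c∈ (nonuniversal≢u (proj₂ (∈sep⁻ W? c∈W))) , a≢c , a≁c)

    result : Buildable S
    result with any? (λ y → any? (λ w → outer? y ×-dec w ∈? W ×-dec y ~? w))
              | any? (λ u → u ∈? D ×-dec ¬? (nonuniversal? u))
    ... | no none | _ = closed-module none
    ... | yes (y , w , y-out , w∈W , yw) | yes (u , u∈ , ¬nu) = Enlarge.enlarged u∈ ¬nu y-out w∈W yw
    ... | yes (y , w , y-out , w∈W , yw) | no none =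
      Legs.spider-buildable nonuniversal y-out (W⊆D w∈W) yw ih
      where
      nonuniversal : ∀ {u} → u ∈ D → Nonuniversal u
      nonuniversal {u} u∈ with nonuniversal? u
      ... | yes nu = nu
      ... | no ¬nu = contradiction (u , u∈ , ¬nu) none

  buildable : ∀ {S} → Acc _⊂_ S → Buildable S
  buildable {S} (acc rec) with any? (λ v → any? (λ b → any? (λ a → any? (λ c →
    v ∈? S ×-dec b ∈? S ×-dec a ∈? S ×-dec c ∈? S ×-dec v ~? b ×-dec a ~? v ×-dec a ~? b ×-dec
    c ~? v ×-dec c ~? b ×-dec ¬? (a ≟ c) ×-dec ¬? (a ~? c)))))
  ... | yes (v , b , a , c , v∈ , b∈ , a∈ , c∈ , vb , av , ab , cv , cb , a≢c , a≁c) =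
    -- An end `v` of the middle edge becomes `e`; both tips see the other end `b`, so they lie in
    -- its component of the neighbourhood of `v`.
    grow-or-build (λ T⊂S → buildable (rec T⊂S)) v∈ comp (⊃-wellFounded _)
      (a , c , closed x∈C (∈sep⁺ (neighbour? S v) (a∈ , av)) (~-sym ab)
             , closed x∈C (∈sep⁺ (neighbour? S v) (c∈ , cv)) (~-sym cb) , a≢c , a≁c)
    where
    comp = component (neighbours S v) (∈sep⁺ (neighbour? S v) (b∈ , ~-sym vb))
    open Component comp
  ... | no none = λ c → recolour c (block chordal (acc rec) diamond-free {⊥} record
      { Q⊆S = λ v∈ → contradiction v∈ ∉⊥
      ; clique = λ v∈ → contradiction v∈ ∉⊥
      ; few = λ _ _ v∈ → contradiction v∈ ∉⊥ })
    where
    diamond-free : DiamondFree S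
    diamond-free {v} {b} {a} {c} v∈ b∈ a∈ c∈ vb av ab cv cb a≢c with a ~? c
    ... | yes ac = ac
    ... | no a≁c = contradiction
      (v , b , a , c , v∈ , b∈ , a∈ , c∈ , vb , av , ab , cv , cb , a≢c , a≁c) none

theorem6 : (G : Graph) → Chordal G → co-S112 Free G → CliqueWidth≤ 4 G
theorem6 G chordal kite-free =
  TwoLabelled.Built⇒CliqueWidth≤4 G (Decompose.buildable G chordal kite-free (⊂-wellFounded _) true)
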